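{- For every integer $m\ge2$, $$f^{(m)}_1(1)=\frac{m-1}{2},$$ and for every integer $k\ge2$, $$f^{(m)}_k(1)=\frac{1}{(k-1)!}\sum_{j=2}^{k}\frac{B_j}{j}\,\mathrm{stirl}(k-1,j-1)\,(m^j-1).$$
   Context: For $m\ge2$, $\Psi_m(x)=1+x+\cdots+x^{m-1}$ and $f^{(m)}_k(x)=\big(-\tfrac1m x\Psi_m'(x)\big)^k\ \mathrm{rem}\ \Psi_m(x)$, where $f\ \mathrm{rem}\ q$ denotes the remainder of $f$ on Euclidean division by $q$. $B_j$ are the Bernoulli numbers ($\frac{t}{e^t-1}=\sum_{j\ge0}B_jt^j/j!$). $\mathrm{stirl}(k,j)$ are the unsigned Stirling numbers of the first kind, satisfying $\mathrm{stirl}(k,j)=\mathrm{stirl}(k-1,j-1)+(k-1)\,\mathrm{stirl}(k-1,j)$, $\mathrm{stirl}(0,0)=1$. -}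

module Defs where

open import Algebra.Bundles.Raw using (RawSemiring)
open import Data.Fin.Base as Fin using (Fin; toℕ)
open import Data.Integer.Base as ℤ using (+_)
open import Data.List.Base using (List; []; _∷_; map; foldr; replicate)
open import Data.Nat.Base as ℕ using (ℕ; zero; suc; _∸_; _!; NonTrivial; s≤s)
import Data.Nat.Properties as ℕ
open import Data.Rational.Base
open import Data.Rational.Properties
import Data.Rational.Unnormalised.Base as ℚᵘ
import Data.Rational.Unnormalised.Properties as ℚᵘ
open import Data.Rational.Solver using (module +-*-Solver)
open import Data.Sum.Base using (inj₁; inj₂)
open import Data.Vec.Functional as Vector using (Vector)
open import Function.Base using (_∘_)
open import Level using (0ℓ)
open import Relation.Binary.PropositionalEquality
  using (_≡_; _≢_; refl; sym; trans; cong; cong₂; module ≡-Reasoning)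
open import Algebra.Properties.Monoid.Sum +-0-monoid public
  using (sum; sum-syntax; sum⁺-syntax)
open import Algebra.Properties.Monoid.Sum +-0-monoid using (sum-cong-≗)

fromℕ : ℕ → ℚ
fromℕ n = + n / 1

1/[_!] : ℕ → ℚ
1/[ n !] = (+ 1 / n !) {{n ℕ.!≢0}}

-- Polynomials over ℚ are coefficient lists, constant term first.  Trailing
-- zeros are allowed, so equality of polynomials is _≈ₚ_ and not _≡_.

Poly : Set
Poly = List ℚ

coeff : Poly → ℕ → ℚ
coeff []      _       = 0ℚ
coeff (a ∷ p) zero    = a
coeff (a ∷ p) (suc n) = coeff p n

infix 4 _≈ₚ_
_≈ₚ_ : Poly → Poly → Set
p ≈ₚ q = ∀ n → coeff p n ≡ coeff q n

infixl 6 _+ₚ_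
infixl 7 _*ₚ_ _·ₚ_

_+ₚ_ : Poly → Poly → Poly
[]      +ₚ q       = q
(a ∷ p) +ₚ []      = a ∷ p
(a ∷ p) +ₚ (b ∷ q) = (a + b) ∷ (p +ₚ q)

_·ₚ_ : ℚ → Poly → Poly
c ·ₚ p = map (c *_) p

_*ₚ_ : Poly → Poly → Poly
[]      *ₚ q = []
(a ∷ p) *ₚ q = (a ·ₚ q) +ₚ (0ℚ ∷ (p *ₚ q))

polyRawSemiring : RawSemiring 0ℓ 0ℓ
polyRawSemiring = record
  { _≈_ = _≈ₚ_
  ; _+_ = _+ₚ_
  ; _*_ = _*ₚ_
  ; 0#  = []
  ; 1#  = 1ℚ ∷ []
  }

open import Algebra.Definitions.RawSemiring polyRawSemiring public
  using () renaming (_^_ to _^ₚ_)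

eval : Poly → ℚ → ℚ
eval p x = foldr (λ a y → a + x * y) 0ℚ p

Xₚ : Poly
Xₚ = 0ℚ ∷ 1ℚ ∷ []

-- weight n (a₀ ∷ a₁ ∷ …) = n a₀ ∷ (n + 1) a₁ ∷ …

weight : ℕ → Poly → Poly
weight n []      = []
weight n (a ∷ p) = fromℕ n * a ∷ weight (suc n) p

deriv : Poly → Poly
deriv []      = []
deriv (_ ∷ p) = weight 1 p

record _HasDegree_ (q : Poly) (d : ℕ) : Set where
  field
    leading≢0 : coeff q d ≢ 0ℚ
    above≡0   : ∀ i → d ℕ.< i → coeff q i ≡ 0ℚ

-- Euclidean division of f by a polynomial q of degree d.

record DivMod (f q : Poly) (d : ℕ) : Set where
  field
    quotient         : Poly
    remainder        : Poly
    property         : f ≈ₚ quotient *ₚ q +ₚ remainder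
    remainder-degree : ∀ i → d ℕ.≤ i → coeff remainder i ≡ 0ℚ

coeff-+ₚ : ∀ p q n → coeff (p +ₚ q) n ≡ coeff p n + coeff q n
coeff-+ₚ []      q       n       = sym (+-identityˡ (coeff q n))
coeff-+ₚ (a ∷ p) []      n       = sym (+-identityʳ (coeff (a ∷ p) n))
coeff-+ₚ (a ∷ p) (b ∷ q) zero    = refl
coeff-+ₚ (a ∷ p) (b ∷ q) (suc n) = coeff-+ₚ p q n

coeff-·ₚ : ∀ c p n → coeff (c ·ₚ p) n ≡ c * coeff p n
coeff-·ₚ c []      n       = sym (*-zeroʳ c)
coeff-·ₚ c (a ∷ p) zero    = refl
coeff-·ₚ c (a ∷ p) (suc n) = coeff-·ₚ c p n

divMod : ∀ f q {d} → q HasDegree d → DivMod f q d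
divMod []      q     q-deg = record
  { quotient         = []
  ; remainder        = []
  ; property         = λ _ → refl
  ; remainder-degree = λ _ _ → refl
  }
divMod (a ∷ f) q {d} q-deg = record
  { quotient         = c ∷ s
  ; remainder        = r′
  ; property         = property′
  ; remainder-degree = λ i d≤i → trans (coeff-r′ i) (degree′ i d≤i)
  }
  where
  open _HasDegree_ q-deg
  open DivMod (divMod f q q-deg) renaming (quotient to s; remainder to r)

  instance
    lead-nonZero : NonZero (coeff q d)
    lead-nonZero = ≢-nonZero leading≢0

  t = a ∷ r
  c = coeff t d ÷ coeff q d
  r′ = t +ₚ (- c) ·ₚ q

  coeff-r′ : ∀ i → coeff r′ i ≡ coeff t i + (- c) * coeff q i
  coeff-r′ i = trans (coeff-+ₚ t ((- c) ·ₚ q) i) (cong (_+_ (coeff t i)) (coeff-·ₚ (- c) q i))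

  shifted : ∀ n → coeff (a ∷ f) n ≡ coeff (0ℚ ∷ s *ₚ q) n + coeff t n
  shifted zero    = sym (+-identityˡ a)
  shifted (suc n) = trans (property n) (coeff-+ₚ (s *ₚ q) r n)

  property′ : (a ∷ f) ≈ₚ (c ∷ s) *ₚ q +ₚ r′
  property′ n = begin
    coeff (a ∷ f) n
      ≡⟨ shifted n ⟩
    u + v
      ≡⟨ solve 4 (λ c w u v → u :+ v := (c :* w :+ u) :+ (v :+ (:- c) :* w)) refl c w u v ⟩
    (c * w + u) + (v + (- c) * w)
      ≡⟨ cong₂ _+_ (cong (_+ u) (coeff-·ₚ c q n)) (coeff-r′ n) ⟨
    (coeff (c ·ₚ q) n + u) + coeff r′ n
      ≡⟨ cong (_+ coeff r′ n) (coeff-+ₚ (c ·ₚ q) (0ℚ ∷ s *ₚ q) n) ⟨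
    coeff ((c ∷ s) *ₚ q) n + coeff r′ n
      ≡⟨ coeff-+ₚ ((c ∷ s) *ₚ q) r′ n ⟨
    coeff ((c ∷ s) *ₚ q +ₚ r′) n ∎
    where
    open ≡-Reasoning
    open +-*-Solver
    u = coeff (0ℚ ∷ s *ₚ q) n
    v = coeff t n
    w = coeff q n

  above-t : ∀ i → d ℕ.< i → coeff t i ≡ 0ℚ
  above-t (suc i) (s≤s d≤i) = remainder-degree i d≤i

  c*lead : c * coeff q d ≡ coeff t d
  c*lead = begin
    coeff t d * 1/ coeff q d * coeff q d   ≡⟨ *-assoc (coeff t d) _ _ ⟩
    coeff t d * (1/ coeff q d * coeff q d) ≡⟨ cong (coeff t d *_) (*-inverseˡ (coeff q d)) ⟩
    coeff t d * 1ℚ                         ≡⟨ *-identityʳ _ ⟩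
    coeff t d                              ∎
    where open ≡-Reasoning

  degree′ : ∀ i → d ℕ.≤ i → coeff t i + (- c) * coeff q i ≡ 0ℚ
  degree′ i d≤i with ℕ.m≤n⇒m<n∨m≡n d≤i
  ... | inj₁ d<i  = begin
    coeff t i + (- c) * coeff q i ≡⟨ cong₂ (λ x y → x + (- c) * y) (above-t i d<i) (above≡0 i d<i) ⟩
    0ℚ + (- c) * 0ℚ               ≡⟨ cong (_+_ 0ℚ) (*-zeroʳ (- c)) ⟩
    0ℚ                            ∎
    where open ≡-Reasoning
  ... | inj₂ refl = begin
    coeff t d + (- c) * coeff q d   ≡⟨ cong (_+_ (coeff t d)) (neg-distribˡ-* c (coeff q d)) ⟨
    coeff t d + - (c * coeff q d)   ≡⟨ cong (λ x → coeff t d + - x) c*lead ⟩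
    coeff t d + - coeff t d         ≡⟨ +-inverseʳ (coeff t d) ⟩
    0ℚ                              ∎
    where open ≡-Reasoning

infixl 7 _rem_
_rem_ : (f q : Poly) {d : ℕ} {{q-deg : q HasDegree d}} → Poly
_rem_ f q {{q-deg}} = DivMod.remainder (divMod f q q-deg)

Ψ : ℕ → Poly
Ψ m = replicate m 1ℚ

instance
  Ψ-degree : ∀ {n} → Ψ (suc n) HasDegree n
  Ψ-degree {n} = record
    { leading≢0 = λ eq → 1≢0 (trans (sym (at n)) eq)
    ; above≡0   = beyond (suc n)
    }
    where
    at : ∀ n → coeff (Ψ (suc n)) n ≡ 1ℚ
    at zero    = refl
    at (suc n) = at n
    beyond : ∀ m i → m ℕ.≤ i → coeff (Ψ m) i ≡ 0ℚ
    beyond zero    i       _         = refl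
    beyond (suc m) (suc i) (s≤s m≤i) = beyond m i m≤i

fₚ : (m : ℕ) .{{_ : NonTrivial m}} → ℕ → Poly
fₚ m@(suc (suc _)) k = ((- (+ 1 / m)) ·ₚ (Xₚ *ₚ deriv (Ψ m))) ^ₚ k rem Ψ m

-- Formal power series over ℚ, used only to define the Bernoulli numbers.

Series : Set
Series = ℕ → ℚ

infixl 7 _⊛_
_⊛_ : Series → Series → Series
(f ⊛ g) n = ∑[ i ≤ n ] (f (n ∸ toℕ i) * g (toℕ i))

egf : (ℕ → ℚ) → Series
egf a j = a j * 1/[ j !]

exp-1 : Series
exp-1 zero    = 0ℚ
exp-1 (suc n) = 1/[ suc n !]

Xₛ : Series
Xₛ 1 = 1ℚ
Xₛ _ = 0ℚ

-- Multiplicative inverse of a series with constant term 1: the entries of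
-- invRow g n are the coefficients of 1/g of index n, n - 1, …, 0.

invRow : Series → (n : ℕ) → Vector ℚ (suc n)
invRow g zero    = 1ℚ Vector.∷ Vector.[]
invRow g (suc n) = (- ∑[ i ≤ n ] (invRow g n i * g (suc (toℕ i)))) Vector.∷ invRow g n

inv : Series → Series
inv g n = invRow g n Fin.zero

-- t / (eᵗ - 1) is the inverse of (eᵗ - 1) / t; see bernoulli-egf.

bernoulli : ℕ → ℚ
bernoulli j = fromℕ (j !) * inv (exp-1 ∘ suc) j

invRow-inv : ∀ g n i → inv g (n ∸ toℕ i) ≡ invRow g n i
invRow-inv g zero    Fin.zero    = refl
invRow-inv g (suc n) Fin.zero    = refl
invRow-inv g (suc n) (Fin.suc i) = invRow-inv g n i

fromℕ-!-inverse : ∀ j → fromℕ (j !) * 1/[ j !] ≡ 1ℚ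
fromℕ-!-inverse j = lemma (j !) {{j ℕ.!≢0}}
  where
  lemma : ∀ n .{{_ : ℕ.NonZero n}} → fromℕ n * (+ 1 / n) ≡ 1ℚ
  lemma n@(suc n-1) = toℚᵘ-injective (begin
    toℚᵘ (fromℕ n * (+ 1 / n))            ≈⟨ toℚᵘ-homo-* (fromℕ n) (+ 1 / n) ⟩
    toℚᵘ (fromℕ n) ℚᵘ.* toℚᵘ (+ 1 / n)    ≈⟨ ℚᵘ.*-cong (toℚᵘ-fromℚᵘ (ℚᵘ.mkℚᵘ (+ n) 0))
                                                        (toℚᵘ-fromℚᵘ (ℚᵘ.mkℚᵘ (+ 1) n-1)) ⟩
    ℚᵘ.mkℚᵘ (+ n) 0 ℚᵘ.* ℚᵘ.mkℚᵘ (+ 1) n-1 ≈⟨ ℚᵘ.*-inverseʳ (ℚᵘ.mkℚᵘ (+ n) 0) ⟩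
    ℚᵘ.1ℚᵘ ∎)
    where open ℚᵘ.≃-Reasoning

egf-bernoulli : ∀ j → egf bernoulli j ≡ inv (exp-1 ∘ suc) j
egf-bernoulli j = begin
  x * y * z   ≡⟨ solve 3 (λ x y z → x :* y :* z := x :* z :* y) refl x y z ⟩
  x * z * y   ≡⟨ cong (_* y) (fromℕ-!-inverse j) ⟩
  1ℚ * y      ≡⟨ *-identityˡ y ⟩
  y           ∎
  where
  open ≡-Reasoning
  open +-*-Solver
  x = fromℕ (j !)
  y = inv (exp-1 ∘ suc) j
  z = 1/[ j !]

bernoulli-egf : ∀ n → (egf bernoulli ⊛ exp-1) n ≡ Xₛ n
bernoulli-egf zero    = refl
bernoulli-egf (suc n) = begin
  egf bernoulli (suc n) * 0ℚ + ∑[ i ≤ n ] (egf bernoulli (n ∸ toℕ i) * g (toℕ i))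
    ≡⟨ cong₂ _+_ (*-zeroʳ (egf bernoulli (suc n))) (sum-cong-≗ term) ⟩
  0ℚ + ∑[ i ≤ n ] (invRow g n i * g (toℕ i))
    ≡⟨ +-identityˡ _ ⟩
  ∑[ i ≤ n ] (invRow g n i * g (toℕ i))
    ≡⟨ delta n ⟩
  Xₛ (suc n) ∎
  where
  open ≡-Reasoning
  g = exp-1 ∘ suc
  term : (i : Fin (suc n)) →
         egf bernoulli (n ∸ toℕ i) * g (toℕ i) ≡ invRow g n i * g (toℕ i)
  term i = cong (_* g (toℕ i)) (trans (egf-bernoulli (n ∸ toℕ i)) (invRow-inv g n i))
  delta : ∀ n → ∑[ i ≤ n ] (invRow g n i * g (toℕ i)) ≡ Xₛ (suc n)
  delta zero    = refl
  delta (suc n) = trans (cong (_+ S) (*-identityʳ (- S))) (+-inverseˡ S)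
    where S = ∑[ i ≤ n ] (invRow g n i * g (suc (toℕ i)))

-- Unsigned Stirling numbers of the first kind, with stirl(k, -1) = 0 and
-- stirl(0, j) = 0 for j > 0.

stirl : ℕ → ℕ → ℕ
stirl zero    zero    = 1
stirl zero    (suc j) = 0
stirl (suc k) zero    = k ℕ.* stirl k zero
stirl (suc k) (suc j) = stirl k j ℕ.+ k ℕ.* stirl k (suc j)

{-# OPTIONS --safe #-}
module Submission where

-- Modulo Ψ m the polynomial - x Ψ′ / m is the inverse of 1 - x, so fₖ - (1 - x) fₖ₊₁
-- is a multiple of Ψ m of degree at most m - 1, hence a scalar one, and evaluation at 1
-- shows fₖ = (fₖ(1) / m) Ψ m + (1 - x) fₖ₊₁. As f₀ = 1, iterating this in powers of
-- y = 1 - x gives ∑ fₖ(1) yᵏ = m / Ψ m (1 - y) = m y / (1 - (1 - y)ᵐ). The substitution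
-- 1 - y = e⁻ᵗ makes the right-hand side a quotient of Bernoulli series, and powers of
-- t = - log (1 - y) expand in y with Stirling numbers as coefficients.

open import Defs
open import Algebra.Bundles using (CommutativeRing)
open import Algebra.Properties.CommutativeMonoid.Sum using (∑-distrib-+)
open import Algebra.Properties.Semiring.Sum using (*-distribˡ-sum)
open import Algebra.Solver.Ring.AlmostCommutativeRing
  using (_-Raw-AlmostCommutative⟶_; fromCommutativeRing)
import Algebra.Solver.Ring
open import Data.Fin.Base as Fin using (toℕ)
open import Data.Integer.Base as ℤ using (+_)
import Data.Integer.Properties as ℤ
open import Data.List.Base using ([]; _∷_)
open import Data.Nat.Base as ℕ using (ℕ; zero; suc; _∸_; _!; NonTrivial; z≤n; s≤s)
import Data.Nat.Properties as ℕ
open import Data.Product.Base using (_×_; _,_; ∃; proj₁; proj₂)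
open import Data.Rational.Base using (ℚ; 0ℚ; 1ℚ; ½; _+_; _-_; -_; _*_; _/_; 1/_; toℚᵘ; NonZero; ≢-nonZero; +-*-rawRing)
open import Data.Rational.Properties
open import Data.Rational.Solver using (module +-*-Solver)
import Data.Rational.Unnormalised.Base as ℚᵘ
import Data.Rational.Unnormalised.Properties as ℚᵘ
open import Function.Base using (_∘_)
open import Level using (0ℓ)
open import Algebra.Properties.Monoid.Sum +-0-monoid using (sum-cong-≗)
open import Relation.Binary.Definitions using (WeaklyDecidable)
open import Relation.Binary.PropositionalEquality
  using (_≡_; _≗_; refl; sym; trans; cong; cong₂; module ≡-Reasoning)
open import Relation.Nullary.Decidable using (dec⇒maybe; map′)

-- Everything takes place in one ring, and neither quotients nor compositions of power series are
-- ever formed. Series in t and series in y are both sequences of exponential coefficients; the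
-- substitution between them is defined by the recurrence that the chain rule dictates, so its
-- properties follow by induction on the coefficient index. Denominators are cleared: every inverse
-- in use is a named series with a product identity, and what is left to divide out is the variable
-- itself. The two cases of the theorem have one source. The generating function involves B₁ with
-- the value +½ instead of -½, and this term carries the factor stirl(k - 1, 0), which is nonzero
-- only at k = 1.

module ℚ-Solver = +-*-Solver

-- Natural numbers inside ℚ

fromℕ-+ : ∀ a b → fromℕ (a ℕ.+ b) ≡ fromℕ a + fromℕ b
fromℕ-+ a b = toℚᵘ-injective (begin
  toℚᵘ (fromℕ (a ℕ.+ b))                ≈⟨ toℚᵘ-fromℚᵘ (ℚᵘ.mkℚᵘ (+ (a ℕ.+ b)) 0) ⟩
  ℚᵘ.mkℚᵘ (+ (a ℕ.+ b)) 0               ≈⟨ ℚᵘ.*≡* (cong (λ z → z ℤ.* + 1)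
                                             (trans (ℤ.pos-+ a b) (sym (cong₂ ℤ._+_ (ℤ.*-identityʳ (+ a)) (ℤ.*-identityʳ (+ b)))))) ⟩
  ℚᵘ.mkℚᵘ (+ a) 0 ℚᵘ.+ ℚᵘ.mkℚᵘ (+ b) 0  ≈⟨ ℚᵘ.+-cong (toℚᵘ-fromℚᵘ (ℚᵘ.mkℚᵘ (+ a) 0))
                                                      (toℚᵘ-fromℚᵘ (ℚᵘ.mkℚᵘ (+ b) 0)) ⟨
  toℚᵘ (fromℕ a) ℚᵘ.+ toℚᵘ (fromℕ b)    ≈⟨ toℚᵘ-homo-+ (fromℕ a) (fromℕ b) ⟨
  toℚᵘ (fromℕ a + fromℕ b)              ∎)
  where open ℚᵘ.≃-Reasoning

fromℕ-suc : ∀ n → fromℕ (suc n) ≡ 1ℚ + fromℕ n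
fromℕ-suc = fromℕ-+ 1

fromℕ-* : ∀ a b → fromℕ (a ℕ.* b) ≡ fromℕ a * fromℕ b
fromℕ-* zero    b = sym (*-zeroˡ (fromℕ b))
fromℕ-* (suc a) b = begin
  fromℕ (b ℕ.+ a ℕ.* b)         ≡⟨ fromℕ-+ b (a ℕ.* b) ⟩
  fromℕ b + fromℕ (a ℕ.* b)     ≡⟨ cong (_+_ (fromℕ b)) (fromℕ-* a b) ⟩
  fromℕ b + fromℕ a * fromℕ b   ≡⟨ solve 2 (λ a b → b :+ a :* b := (con 1ℚ :+ a) :* b) refl (fromℕ a) (fromℕ b) ⟩
  (1ℚ + fromℕ a) * fromℕ b      ≡⟨ cong (_* fromℕ b) (fromℕ-suc a) ⟨
  fromℕ (suc a) * fromℕ b       ∎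
  where
  open ≡-Reasoning
  open ℚ-Solver

*-inverse-fromℕ : ∀ n .{{_ : ℕ.NonZero n}} → (+ 1 / n) * fromℕ n ≡ 1ℚ
*-inverse-fromℕ n@(suc n-1) = toℚᵘ-injective (begin
  toℚᵘ ((+ 1 / n) * fromℕ n)             ≈⟨ toℚᵘ-homo-* (+ 1 / n) (fromℕ n) ⟩
  toℚᵘ (+ 1 / n) ℚᵘ.* toℚᵘ (fromℕ n)     ≈⟨ ℚᵘ.*-cong (toℚᵘ-fromℚᵘ (ℚᵘ.mkℚᵘ (+ 1) n-1))
                                                      (toℚᵘ-fromℚᵘ (ℚᵘ.mkℚᵘ (+ n) 0)) ⟩
  ℚᵘ.mkℚᵘ (+ 1) n-1 ℚᵘ.* ℚᵘ.mkℚᵘ (+ n) 0 ≈⟨ ℚᵘ.*-inverseˡ (ℚᵘ.mkℚᵘ (+ n) 0) ⟩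
  ℚᵘ.1ℚᵘ                                 ∎)
  where open ℚᵘ.≃-Reasoning

fromℕ-cancelˡ : ∀ n .{{_ : ℕ.NonZero n}} {x y} → fromℕ n * x ≡ fromℕ n * y → x ≡ y
fromℕ-cancelˡ n {x} {y} eq = begin
  x                          ≡⟨ unit x ⟨
  (+ 1 / n) * (fromℕ n * x)  ≡⟨ cong ((+ 1 / n) *_) eq ⟩
  (+ 1 / n) * (fromℕ n * y)  ≡⟨ unit y ⟩
  y                          ∎
  where
  open ≡-Reasoning
  unit : ∀ z → (+ 1 / n) * (fromℕ n * z) ≡ z
  unit z = trans (sym (*-assoc (+ 1 / n) (fromℕ n) z))
                 (trans (cong (_* z) (*-inverse-fromℕ n)) (*-identityˡ z))

-- The Hurwitz ring

-- A sequence a stands for the exponential series ∑ aₙ tⁿ / n!, so that the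
-- shift a ∘ suc is the derivative and the product is given by Leibniz' rule.

infixl 6 _⊕_
infixl 7 _⊙_
infix  8 ⊝_

_⊕_ : Series → Series → Series
(a ⊕ b) n = a n + b n

⊝_ : Series → Series
(⊝ a) n = - a n

const : ℚ → Series
const c zero    = c
const c (suc _) = 0ℚ

_⊙_ : Series → Series → Series
(a ⊙ b) zero    = a 0 * b 0
(a ⊙ b) (suc n) = (a ∘ suc ⊙ b) n + (a ⊙ b ∘ suc) n

⊙-cong : ∀ {a a′ b b′} → a ≗ a′ → b ≗ b′ → a ⊙ b ≗ a′ ⊙ b′
⊙-cong p q zero    = cong₂ _*_ (p 0) (q 0)
⊙-cong p q (suc n) = cong₂ _+_ (⊙-cong (p ∘ suc) q n) (⊙-cong p (q ∘ suc) n)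

⊙-comm : ∀ a b → a ⊙ b ≗ b ⊙ a
⊙-comm a b zero    = *-comm (a 0) (b 0)
⊙-comm a b (suc n) = trans (cong₂ _+_ (⊙-comm (a ∘ suc) b n) (⊙-comm a (b ∘ suc) n))
                           (+-comm ((b ⊙ a ∘ suc) n) ((b ∘ suc ⊙ a) n))

⊙-distribʳ-⊕ : ∀ c a b → (a ⊕ b) ⊙ c ≗ a ⊙ c ⊕ b ⊙ c
⊙-distribʳ-⊕ c a b zero    = *-distribʳ-+ (c 0) (a 0) (b 0)
⊙-distribʳ-⊕ c a b (suc n) = begin
  ((a ∘ suc ⊕ b ∘ suc) ⊙ c) n + ((a ⊕ b) ⊙ c ∘ suc) n
    ≡⟨ cong₂ _+_ (⊙-distribʳ-⊕ c (a ∘ suc) (b ∘ suc) n) (⊙-distribʳ-⊕ (c ∘ suc) a b n) ⟩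
  ((a ∘ suc ⊙ c) n + (b ∘ suc ⊙ c) n) + ((a ⊙ c ∘ suc) n + (b ⊙ c ∘ suc) n)
    ≡⟨ solve 4 (λ x y z w → (x :+ y) :+ (z :+ w) := (x :+ z) :+ (y :+ w)) refl
         ((a ∘ suc ⊙ c) n) ((b ∘ suc ⊙ c) n) ((a ⊙ c ∘ suc) n) ((b ⊙ c ∘ suc) n) ⟩
  ((a ∘ suc ⊙ c) n + (a ⊙ c ∘ suc) n) + ((b ∘ suc ⊙ c) n + (b ⊙ c ∘ suc) n) ∎
  where
  open ≡-Reasoning
  open ℚ-Solver

⊙-distribˡ-⊕ : ∀ c a b → c ⊙ (a ⊕ b) ≗ c ⊙ a ⊕ c ⊙ b
⊙-distribˡ-⊕ c a b n = trans (⊙-comm c (a ⊕ b) n) (trans (⊙-distribʳ-⊕ c a b n)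
                         (cong₂ _+_ (⊙-comm a c n) (⊙-comm b c n)))

⊙-assoc : ∀ a b c → (a ⊙ b) ⊙ c ≗ a ⊙ (b ⊙ c)
⊙-assoc a b c zero    = *-assoc (a 0) (b 0) (c 0)
⊙-assoc a b c (suc n) = begin
  ((a ∘ suc ⊙ b ⊕ a ⊙ b ∘ suc) ⊙ c) n + ((a ⊙ b) ⊙ c ∘ suc) n
    ≡⟨ cong₂ _+_ (⊙-distribʳ-⊕ c (a ∘ suc ⊙ b) (a ⊙ b ∘ suc) n) (⊙-assoc a b (c ∘ suc) n) ⟩
  (((a ∘ suc ⊙ b) ⊙ c) n + ((a ⊙ b ∘ suc) ⊙ c) n) + (a ⊙ (b ⊙ c ∘ suc)) n
    ≡⟨ cong (_+ (a ⊙ (b ⊙ c ∘ suc)) n) (cong₂ _+_ (⊙-assoc (a ∘ suc) b c n) (⊙-assoc a (b ∘ suc) c n)) ⟩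
  ((a ∘ suc ⊙ (b ⊙ c)) n + (a ⊙ (b ∘ suc ⊙ c)) n) + (a ⊙ (b ⊙ c ∘ suc)) n
    ≡⟨ +-assoc ((a ∘ suc ⊙ (b ⊙ c)) n) _ _ ⟩
  (a ∘ suc ⊙ (b ⊙ c)) n + ((a ⊙ (b ∘ suc ⊙ c)) n + (a ⊙ (b ⊙ c ∘ suc)) n)
    ≡⟨ cong (_+_ ((a ∘ suc ⊙ (b ⊙ c)) n)) (⊙-distribˡ-⊕ a (b ∘ suc ⊙ c) (b ⊙ c ∘ suc) n) ⟨
  (a ∘ suc ⊙ (b ⊙ c)) n + (a ⊙ (b ∘ suc ⊙ c ⊕ b ⊙ c ∘ suc)) n ∎
  where open ≡-Reasoning

⊙-zeroˡ : ∀ a → (λ _ → 0ℚ) ⊙ a ≗ λ _ → 0ℚ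
⊙-zeroˡ a zero    = *-zeroˡ (a 0)
⊙-zeroˡ a (suc n) = cong₂ _+_ (⊙-zeroˡ a n) (⊙-zeroˡ (a ∘ suc) n)

const-⊙ : ∀ c a n → (const c ⊙ a) n ≡ c * a n
const-⊙ c a zero    = refl
const-⊙ c a (suc n) = trans (cong₂ _+_ (⊙-zeroˡ a n) (const-⊙ c (a ∘ suc) n)) (+-identityˡ _)

const-0 : const 0ℚ ≗ λ _ → 0ℚ
const-0 zero    = refl
const-0 (suc _) = refl

const-+ : ∀ c d → const (c + d) ≗ const c ⊕ const d
const-+ c d zero    = refl
const-+ c d (suc n) = refl

const-* : ∀ c d → const (c * d) ≗ const c ⊙ const d
const-* c d zero    = refl
const-* c d (suc n) = sym (trans (const-⊙ c (const d) (suc n)) (*-zeroʳ c))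

const-neg : ∀ c → const (- c) ≗ ⊝ const c
const-neg c zero    = refl
const-neg c (suc n) = refl

hurwitzRing : CommutativeRing 0ℓ 0ℓ
hurwitzRing = record
  { Carrier = Series
  ; _≈_     = _≗_
  ; _+_     = _⊕_
  ; _*_     = _⊙_
  ; -_      = ⊝_
  ; 0#      = λ _ → 0ℚ
  ; 1#      = const 1ℚ
  ; isCommutativeRing = record
    { isRing = record
      { +-isAbelianGroup = record
        { isGroup = record
          { isMonoid = record
            { isSemigroup = record
              { isMagma = record
                { isEquivalence = record
                  { refl  = λ _ → refl
                  ; sym   = λ p n → sym (p n)
                  ; trans = λ p q n → trans (p n) (q n)
                  }
                ; ∙-cong = λ p q n → cong₂ _+_ (p n) (q n)
                }
              ; assoc = λ a b c n → +-assoc (a n) (b n) (c n)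
              }
            ; identity = (λ a n → +-identityˡ (a n)) , (λ a n → +-identityʳ (a n))
            }
          ; inverse = (λ a n → +-inverseˡ (a n)) , (λ a n → +-inverseʳ (a n))
          ; ⁻¹-cong = λ p n → cong -_ (p n)
          }
        ; comm = λ a b n → +-comm (a n) (b n)
        }
      ; *-cong     = ⊙-cong
      ; *-assoc    = ⊙-assoc
      ; *-identity = one-⊙ , λ a n → trans (⊙-comm a (const 1ℚ) n) (one-⊙ a n)
      ; distrib    = ⊙-distribˡ-⊕ , ⊙-distribʳ-⊕
      }
    ; *-comm = ⊙-comm
    }
  }
  where
  one-⊙ : ∀ a → const 1ℚ ⊙ a ≗ a
  one-⊙ a n = trans (const-⊙ 1ℚ a n) (*-identityˡ (a n))

module H where
  open CommutativeRing hurwitzRing public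
  open import Relation.Binary.Reasoning.Setoid setoid public

const-morphism : +-*-rawRing -Raw-AlmostCommutative⟶ fromCommutativeRing hurwitzRing
const-morphism = record
  { ⟦_⟧    = const
  ; +-homo = const-+
  ; *-homo = const-*
  ; -‿homo = const-neg
  ; 0-homo = const-0
  ; 1-homo = λ _ → refl
  }

const-≟ : WeaklyDecidable (λ c d → const c ≗ const d)
const-≟ c d = dec⇒maybe (map′ (λ { refl _ → refl }) (λ eq → eq 0) (c ≟ d))

-- Rational constants enter through `const` as coefficients, so the solver computes with them; every
-- other series is an atom.
module H-Solver = Algebra.Solver.Ring +-*-rawRing (fromCommutativeRing hurwitzRing) const-morphism const-≟

const-cong : ∀ {c d} → c ≡ d → const c ≗ const d
const-cong refl _ = refl

const-fromℕ-suc : ∀ n → const (fromℕ (suc n)) ≗ const 1ℚ ⊕ const (fromℕ n)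
const-fromℕ-suc n = H.trans (const-cong (fromℕ-suc n)) (const-+ 1ℚ (fromℕ n))

-- Multiplication by the variable

up : Series → Series
up a zero    = 0ℚ
up a (suc n) = fromℕ (suc n) * a n

up-cong : ∀ {a b} → a ≗ b → up a ≗ up b
up-cong p zero    = refl
up-cong p (suc n) = cong (fromℕ (suc n) *_) (p n)

up-shift : ∀ a n → up (a ∘ suc) n ≡ fromℕ n * a n
up-shift a zero    = sym (*-zeroˡ (a 0))
up-shift a (suc n) = refl

up-⊕ : ∀ a b → up (a ⊕ b) ≗ up a ⊕ up b
up-⊕ a b zero    = refl
up-⊕ a b (suc n) = *-distribˡ-+ (fromℕ (suc n)) (a n) (b n)

-- Product rule: (t a)′ = a + t a′.
up-suc : ∀ a → up a ∘ suc ≗ a ⊕ up (a ∘ suc)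
up-suc a n = begin
  fromℕ (suc n) * a n        ≡⟨ cong (_* a n) (fromℕ-suc n) ⟩
  (1ℚ + fromℕ n) * a n       ≡⟨ solve 2 (λ x y → (con 1ℚ :+ x) :* y := y :+ x :* y) refl (fromℕ n) (a n) ⟩
  a n + fromℕ n * a n        ≡⟨ cong (_+_ (a n)) (up-shift a n) ⟨
  a n + up (a ∘ suc) n       ∎
  where
  open ≡-Reasoning
  open ℚ-Solver

-- Both sides vanish at index 0. By `up-suc` their derivatives agree at n once the claim holds there
-- for the pairs (a′, b) and (a, b′).
up-⊙ : ∀ a b → up a ⊙ b ≗ up (a ⊙ b)
up-⊙ a b zero    = *-zeroˡ (b 0)
up-⊙ a b (suc n) = begin
  (up a ∘ suc ⊙ b) n + (up a ⊙ b ∘ suc) n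
    ≡⟨ cong (_+ (up a ⊙ b ∘ suc) n) (trans (⊙-cong (up-suc a) (λ _ → refl) n) (⊙-distribʳ-⊕ b a (up (a ∘ suc)) n)) ⟩
  ((a ⊙ b) n + (up (a ∘ suc) ⊙ b) n) + (up a ⊙ b ∘ suc) n
    ≡⟨ cong₂ (λ x y → ((a ⊙ b) n + x) + y) (up-⊙ (a ∘ suc) b n) (up-⊙ a (b ∘ suc) n) ⟩
  ((a ⊙ b) n + up (a ∘ suc ⊙ b) n) + up (a ⊙ b ∘ suc) n
    ≡⟨ +-assoc ((a ⊙ b) n) _ _ ⟩
  (a ⊙ b) n + (up (a ∘ suc ⊙ b) n + up (a ⊙ b ∘ suc) n)
    ≡⟨ cong (_+_ ((a ⊙ b) n)) (up-⊕ (a ∘ suc ⊙ b) (a ⊙ b ∘ suc) n) ⟨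
  (a ⊙ b) n + up ((a ⊙ b) ∘ suc) n
    ≡⟨ up-suc (a ⊙ b) n ⟨
  up (a ⊙ b) (suc n) ∎
  where open ≡-Reasoning

X : Series
X = up (const 1ℚ)

X-⊙ : ∀ a → X ⊙ a ≗ up a
X-⊙ a n = trans (up-⊙ (const 1ℚ) a n) (up-cong (H.*-identityˡ a) n)

-- Coefficient n + 1 of `X ⊙ a` is (n + 1) aₙ, which determines aₙ. This replaces division by y in
-- `generating-function`.
X-cancelˡ : ∀ a b → X ⊙ a ≗ X ⊙ b → a ≗ b
X-cancelˡ a b eq n = fromℕ-cancelˡ (suc n)
  (trans (sym (X-⊙ a (suc n))) (trans (eq (suc n)) (X-⊙ b (suc n))))

-- ordinary f is the ordinary series ∑ fₙ tⁿ as an element of the Hurwitz ring.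

ordinary : Series → Series
ordinary f n = fromℕ (n !) * f n

ordinary-unfold : ∀ f → ordinary f ≗ const (f 0) ⊕ up (ordinary (f ∘ suc))
ordinary-unfold f zero    = trans (*-identityˡ (f 0)) (sym (+-identityʳ (f 0)))
ordinary-unfold f (suc n) = begin
  fromℕ (suc n ℕ.* n !) * f (suc n)            ≡⟨ cong (_* f (suc n)) (fromℕ-* (suc n) (n !)) ⟩
  fromℕ (suc n) * fromℕ (n !) * f (suc n)      ≡⟨ *-assoc (fromℕ (suc n)) _ _ ⟩
  fromℕ (suc n) * (fromℕ (n !) * f (suc n))    ≡⟨ +-identityˡ _ ⟨
  0ℚ + fromℕ (suc n) * (fromℕ (n !) * f (suc n)) ∎
  where open ≡-Reasoning

ordinary-⊙ : ∀ f a → ordinary f ⊙ a ≗ const (f 0) ⊙ a ⊕ up (ordinary (f ∘ suc) ⊙ a)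
ordinary-⊙ f a n = begin
  (ordinary f ⊙ a) n
    ≡⟨ ⊙-cong (ordinary-unfold f) (λ _ → refl) n ⟩
  ((const (f 0) ⊕ up (ordinary (f ∘ suc))) ⊙ a) n
    ≡⟨ ⊙-distribʳ-⊕ a (const (f 0)) (up (ordinary (f ∘ suc))) n ⟩
  (const (f 0) ⊙ a) n + (up (ordinary (f ∘ suc)) ⊙ a) n
    ≡⟨ cong (_+_ ((const (f 0) ⊙ a) n)) (up-⊙ (ordinary (f ∘ suc)) a n) ⟩
  (const (f 0) ⊙ a) n + up (ordinary (f ∘ suc) ⊙ a) n ∎
  where open ≡-Reasoning

-- The sum in `_⊛_` splits off the term with g 0, so the induction unfolds g and not f;
-- commutativity moves g to the left, where `ordinary-⊙` applies.
ordinary-⊛ : ∀ f g → ordinary (f ⊛ g) ≗ ordinary f ⊙ ordinary g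
ordinary-⊛ f g zero    =
  solve 2 (λ x y → con 1ℚ :* (x :* y :+ con 0ℚ) := (con 1ℚ :* x) :* (con 1ℚ :* y)) refl (f 0) (g 0)
  where open ℚ-Solver
ordinary-⊛ f g (suc n) = begin
  F * (f (suc n) * g 0 + (f ⊛ g ∘ suc) n)
    ≡⟨ solve 4 (λ F x y z → F :* (x :* y :+ z) := y :* (F :* x) :+ F :* z) refl F (f (suc n)) (g 0) ((f ⊛ g ∘ suc) n) ⟩
  g 0 * (F * f (suc n)) + F * (f ⊛ g ∘ suc) n
    ≡⟨ cong₂ _+_ (sym (const-⊙ (g 0) (ordinary f) (suc n)))
         (trans (cong (_* (f ⊛ g ∘ suc) n) (fromℕ-* (suc n) (n !)))
                (*-assoc (fromℕ (suc n)) (fromℕ (n !)) _)) ⟩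
  (const (g 0) ⊙ ordinary f) (suc n) + fromℕ (suc n) * ordinary (f ⊛ g ∘ suc) n
    ≡⟨ cong (λ x → (const (g 0) ⊙ ordinary f) (suc n) + fromℕ (suc n) * x)
         (trans (ordinary-⊛ f (g ∘ suc) n) (⊙-comm (ordinary f) (ordinary (g ∘ suc)) n)) ⟩
  (const (g 0) ⊙ ordinary f) (suc n) + fromℕ (suc n) * (ordinary (g ∘ suc) ⊙ ordinary f) n
    ≡⟨ ordinary-⊙ g (ordinary f) (suc n) ⟨
  (ordinary g ⊙ ordinary f) (suc n)
    ≡⟨ ⊙-comm (ordinary g) (ordinary f) (suc n) ⟩
  (ordinary f ⊙ ordinary g) (suc n) ∎
  where
  open ≡-Reasoning
  open ℚ-Solver
  F = fromℕ (suc n !)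

-- Exponentials and Bernoulli numbers

E : Series
E _ = 1ℚ

bernoulli-E : bernoulli ⊙ (E ⊕ ⊝ const 1ℚ) ≗ X
bernoulli-E n = begin
  (bernoulli ⊙ (E ⊕ ⊝ const 1ℚ)) n            ≡⟨ ⊙-cong b≗ e≗ n ⟩
  (ordinary (egf bernoulli) ⊙ ordinary exp-1) n ≡⟨ ordinary-⊛ (egf bernoulli) exp-1 n ⟨
  fromℕ (n !) * (egf bernoulli ⊛ exp-1) n     ≡⟨ cong (fromℕ (n !) *_) (bernoulli-egf n) ⟩
  fromℕ (n !) * Xₛ n                          ≡⟨ x≗ n ⟩
  X n                                         ∎
  where
  open ≡-Reasoning
  b≗ : bernoulli ≗ ordinary (egf bernoulli)
  b≗ n = begin
    bernoulli n                              ≡⟨ *-identityˡ (bernoulli n) ⟨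
    1ℚ * bernoulli n                         ≡⟨ cong (_* bernoulli n) (fromℕ-!-inverse n) ⟨
    fromℕ (n !) * 1/[ n !] * bernoulli n     ≡⟨ solve 3 (λ x y z → x :* y :* z := x :* (z :* y)) refl (fromℕ (n !)) 1/[ n !] (bernoulli n) ⟩
    fromℕ (n !) * (bernoulli n * 1/[ n !])   ∎
    where open ℚ-Solver
  e≗ : E ⊕ ⊝ const 1ℚ ≗ ordinary exp-1
  e≗ zero    = refl
  e≗ (suc n) = sym (fromℕ-!-inverse (suc n))
  x≗ : ordinary Xₛ ≗ X
  x≗ 0             = refl
  x≗ 1             = refl
  x≗ (suc (suc n)) = trans (*-zeroʳ (fromℕ (suc (suc n) !))) (sym (*-zeroʳ (fromℕ (suc (suc n)))))

-- β(t) = t / (1 - e⁻ᵗ)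

β : Series
β = bernoulli ⊕ X

-- With e⁻ᵗ cleared, (B(t) + t)(eᵗ - 1) = t + t (eᵗ - 1) = t eᵗ. Adding t to the Bernoulli series
-- changes B₁ alone.
β-E : β ⊙ (E ⊕ ⊝ const 1ℚ) ≗ X ⊙ E
β-E = H.begin
  β ⊙ (E ⊕ ⊝ const 1ℚ)
    H.≈⟨ solve 3 (λ b x e → (b :+ x) :* (e :- con 1ℚ) := b :* (e :- con 1ℚ) :+ (x :* e :- x)) (λ _ → refl) bernoulli X E ⟩
  bernoulli ⊙ (E ⊕ ⊝ const 1ℚ) ⊕ (X ⊙ E ⊕ ⊝ X)
    H.≈⟨ H.+-congʳ bernoulli-E ⟩
  X ⊕ (X ⊙ E ⊕ ⊝ X)
    H.≈⟨ solve 2 (λ x y → x :+ (y :- x) := y) (λ _ → refl) X (X ⊙ E) ⟩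
  X ⊙ E H.∎
  where open H-Solver

-- dilate m a is the series a(mt).

dilate : ℕ → Series → Series
dilate m a n = fromℕ (m ℕ.^ n) * a n

dilate-cong : ∀ m {a b} → a ≗ b → dilate m a ≗ dilate m b
dilate-cong m p n = cong (fromℕ (m ℕ.^ n) *_) (p n)

-- Chain rule for t ↦ mt.
dilate-suc : ∀ m a → dilate m a ∘ suc ≗ const (fromℕ m) ⊙ dilate m (a ∘ suc)
dilate-suc m a n = begin
  fromℕ (m ℕ.* m ℕ.^ n) * a (suc n)          ≡⟨ cong (_* a (suc n)) (fromℕ-* m (m ℕ.^ n)) ⟩
  fromℕ m * fromℕ (m ℕ.^ n) * a (suc n)      ≡⟨ *-assoc (fromℕ m) _ _ ⟩
  fromℕ m * (fromℕ (m ℕ.^ n) * a (suc n))    ≡⟨ const-⊙ (fromℕ m) (dilate m (a ∘ suc)) n ⟨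
  (const (fromℕ m) ⊙ dilate m (a ∘ suc)) n   ∎
  where open ≡-Reasoning

dilate-const : ∀ m c → dilate m (const c) ≗ const c
dilate-const m c zero    = *-identityˡ c
dilate-const m c (suc n) = *-zeroʳ (fromℕ (m ℕ.^ suc n))

dilate-sub : ∀ m a b → dilate m (a ⊕ ⊝ b) ≗ dilate m a ⊕ ⊝ dilate m b
dilate-sub m a b n = solve 3 (λ c x y → c :* (x :- y) := c :* x :- c :* y) refl (fromℕ (m ℕ.^ n)) (a n) (b n)
  where open ℚ-Solver

dilate-⊙ : ∀ m a b → dilate m (a ⊙ b) ≗ dilate m a ⊙ dilate m b
dilate-⊙ m a b zero    = solve 2 (λ x y → con 1ℚ :* (x :* y) := (con 1ℚ :* x) :* (con 1ℚ :* y)) refl (a 0) (b 0)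
  where open ℚ-Solver
dilate-⊙ m a b (suc n) = begin
  dilate m (a ⊙ b) (suc n)
    ≡⟨ trans (dilate-suc m (a ⊙ b) n) (const-⊙ M (dilate m ((a ⊙ b) ∘ suc)) n) ⟩
  M * (fromℕ (m ℕ.^ n) * ((a ∘ suc ⊙ b) n + (a ⊙ b ∘ suc) n))
    ≡⟨ cong (M *_) (*-distribˡ-+ (fromℕ (m ℕ.^ n)) _ _) ⟩
  M * (dilate m (a ∘ suc ⊙ b) n + dilate m (a ⊙ b ∘ suc) n)
    ≡⟨ cong (M *_) (cong₂ _+_ (dilate-⊙ m (a ∘ suc) b n) (dilate-⊙ m a (b ∘ suc) n)) ⟩
  M * ((dilate m (a ∘ suc) ⊙ dilate m b) n + (dilate m a ⊙ dilate m (b ∘ suc)) n)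
    ≡⟨ const-⊙ M (dilate m (a ∘ suc) ⊙ dilate m b ⊕ dilate m a ⊙ dilate m (b ∘ suc)) n ⟨
  (const M ⊙ (dilate m (a ∘ suc) ⊙ dilate m b ⊕ dilate m a ⊙ dilate m (b ∘ suc))) n
    ≡⟨ HS.solve 5 (λ c x y z w → c HS.:* (x HS.:* y HS.:+ z HS.:* w) HS.:= (c HS.:* x) HS.:* y HS.:+ z HS.:* (c HS.:* w))
         (λ _ → refl) (const M) (dilate m (a ∘ suc)) (dilate m b) (dilate m a) (dilate m (b ∘ suc)) n ⟩
  ((const M ⊙ dilate m (a ∘ suc)) ⊙ dilate m b) n + (dilate m a ⊙ (const M ⊙ dilate m (b ∘ suc))) n
    ≡⟨ cong₂ _+_ (⊙-cong (dilate-suc m a) (λ _ → refl) n) (⊙-cong {a = dilate m a} (λ _ → refl) (dilate-suc m b) n) ⟨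
  (dilate m a ⊙ dilate m b) (suc n) ∎
  where
  open ≡-Reasoning
  module HS = H-Solver
  M = fromℕ m

dilate-X : ∀ m → dilate m X ≗ const (fromℕ m) ⊙ X
dilate-X m zero    = sym (*-zeroʳ (fromℕ m))
dilate-X m (suc n) = begin
  dilate m X (suc n)                                       ≡⟨ dilate-suc m X n ⟩
  (const (fromℕ m) ⊙ dilate m (X ∘ suc)) n                 ≡⟨ const-⊙ (fromℕ m) (dilate m (X ∘ suc)) n ⟩
  fromℕ m * (fromℕ (m ℕ.^ n) * X (suc n))                  ≡⟨ cong (fromℕ m *_) (lemma n) ⟩
  fromℕ m * X (suc n)                                      ≡⟨ const-⊙ (fromℕ m) X (suc n) ⟨
  (const (fromℕ m) ⊙ X) (suc n)                            ∎
  where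
  open ≡-Reasoning
  lemma : ∀ n → fromℕ (m ℕ.^ n) * X (suc n) ≡ X (suc n)
  lemma zero    = refl
  lemma (suc n) = trans (cong (fromℕ (m ℕ.^ suc n) *_) x≡0) (trans (*-zeroʳ (fromℕ (m ℕ.^ suc n))) (sym x≡0))
    where x≡0 = *-zeroʳ (fromℕ (suc (suc n)))

-- Both sides solve F′ = (1 + m) F with F(0) = 1; Leibniz' rule on the right supplies the summands 1
-- and m.
dilate-suc-E : ∀ m → dilate (suc m) E ≗ E ⊙ dilate m E
dilate-suc-E m zero    = refl
dilate-suc-E m (suc n) = begin
  dilate (suc m) E (suc n)
    ≡⟨ trans (dilate-suc (suc m) E n) (const-⊙ (fromℕ (suc m)) (dilate (suc m) E) n) ⟩
  fromℕ (suc m) * dilate (suc m) E n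
    ≡⟨ cong₂ _*_ (fromℕ-suc m) (dilate-suc-E m n) ⟩
  (1ℚ + fromℕ m) * P n
    ≡⟨ solve 2 (λ x y → (con 1ℚ :+ x) :* y := y :+ x :* y) refl (fromℕ m) (P n) ⟩
  P n + fromℕ m * P n
    ≡⟨ cong (_+_ (P n)) (const-⊙ (fromℕ m) P n) ⟨
  P n + (const (fromℕ m) ⊙ P) n
    ≡⟨ cong (_+_ (P n)) (HS.solve 3 (λ c e d → c HS.:* (e HS.:* d) HS.:= e HS.:* (c HS.:* d)) (λ _ → refl)
         (const (fromℕ m)) E (dilate m E) n) ⟩
  P n + (E ⊙ (const (fromℕ m) ⊙ dilate m E)) n
    ≡⟨ cong (_+_ (P n)) (⊙-cong {a = E} (λ _ → refl) (dilate-suc m E) n) ⟨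
  (E ⊙ dilate m E) (suc n) ∎
  where
  open ≡-Reasoning
  open ℚ-Solver
  module HS = H-Solver
  P = E ⊙ dilate m E

-- Substitution of t = - log (1 - y)

-- If b(y) = a(- log (1 - y)), then (1 - y) b′(y) = a′(- log (1 - y)). Since y b′ has n-th
-- exponential coefficient n bₙ, comparing coefficients gives exactly this recurrence for bₙ₊₁.
ψ : Series → Series
ψ a zero    = a 0
ψ a (suc n) = ψ (a ∘ suc) n + fromℕ n * ψ a n

ψ-cong : ∀ {a b} → a ≗ b → ψ a ≗ ψ b
ψ-cong p zero    = p 0
ψ-cong p (suc n) = cong₂ _+_ (ψ-cong (p ∘ suc) n) (cong (fromℕ n *_) (ψ-cong p n))

ψ-⊕ : ∀ a b → ψ (a ⊕ b) ≗ ψ a ⊕ ψ b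
ψ-⊕ a b zero    = refl
ψ-⊕ a b (suc n) = trans (cong₂ (λ x y → x + fromℕ n * y) (ψ-⊕ (a ∘ suc) (b ∘ suc) n) (ψ-⊕ a b n))
  (solve 5 (λ p q c r s → (p :+ q) :+ c :* (r :+ s) := (p :+ c :* r) :+ (q :+ c :* s)) refl
    (ψ (a ∘ suc) n) (ψ (b ∘ suc) n) (fromℕ n) (ψ a n) (ψ b n))
  where open ℚ-Solver

ψ-⊝ : ∀ a → ψ (⊝ a) ≗ ⊝ ψ a
ψ-⊝ a zero    = refl
ψ-⊝ a (suc n) = trans (cong₂ (λ x y → x + fromℕ n * y) (ψ-⊝ (a ∘ suc) n) (ψ-⊝ a n))
  (solve 3 (λ p c q → (:- p) :+ c :* (:- q) := :- (p :+ c :* q)) refl (ψ (a ∘ suc) n) (fromℕ n) (ψ a n))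
  where open ℚ-Solver

ψ-zero : ψ (λ _ → 0ℚ) ≗ λ _ → 0ℚ
ψ-zero zero    = refl
ψ-zero (suc n) = trans (cong₂ (λ x y → x + fromℕ n * y) (ψ-zero n) (ψ-zero n)) (trans (+-identityˡ _) (*-zeroʳ (fromℕ n)))

ψ-const : ∀ c → ψ (const c) ≗ const c
ψ-const c zero          = refl
ψ-const c (suc zero)    = trans (+-identityˡ _) (*-zeroˡ c)
ψ-const c (suc (suc n)) = trans (cong₂ (λ x y → x + fromℕ (suc n) * y) (ψ-zero (suc n)) (ψ-const c (suc n)))
                                (trans (+-identityˡ _) (*-zeroʳ (fromℕ (suc n))))

-- n aₙ is the n-th term of t (da/dt), and t d/dt is a derivation.

euler-⊙ : ∀ a b n → fromℕ n * (a ⊙ b) n ≡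
          ((λ i → fromℕ i * a i) ⊙ b) n + (a ⊙ (λ i → fromℕ i * b i)) n
euler-⊙ a b n = begin
  fromℕ n * (a ⊙ b) n
    ≡⟨ up-shift (a ⊙ b) n ⟨
  up (a ∘ suc ⊙ b ⊕ a ⊙ b ∘ suc) n
    ≡⟨ up-⊕ (a ∘ suc ⊙ b) (a ⊙ b ∘ suc) n ⟩
  up (a ∘ suc ⊙ b) n + up (a ⊙ b ∘ suc) n
    ≡⟨ cong₂ _+_ (sym (up-⊙ (a ∘ suc) b n))
         (trans (up-cong (⊙-comm a (b ∘ suc)) n) (trans (sym (up-⊙ (b ∘ suc) a n)) (⊙-comm (up (b ∘ suc)) a n))) ⟩
  (up (a ∘ suc) ⊙ b) n + (a ⊙ up (b ∘ suc)) n
    ≡⟨ cong₂ _+_ (⊙-cong (up-shift a) (λ _ → refl) n) (⊙-cong {a = a} (λ _ → refl) (up-shift b) n) ⟩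
  ((λ i → fromℕ i * a i) ⊙ b) n + (a ⊙ (λ i → fromℕ i * b i)) n ∎
  where open ≡-Reasoning

-- ψ turns d/dt into (1 - y) d/dy, so both sides satisfy the same recurrence.

ψ-⊙ : ∀ a b → ψ (a ⊙ b) ≗ ψ a ⊙ ψ b
ψ-⊙ a b zero    = refl
ψ-⊙ a b (suc n) = begin
  ψ (a ∘ suc ⊙ b ⊕ a ⊙ b ∘ suc) n + fromℕ n * ψ (a ⊙ b) n
    ≡⟨ cong₂ (λ x y → x + fromℕ n * y) (ψ-⊕ (a ∘ suc ⊙ b) (a ⊙ b ∘ suc) n) (ψ-⊙ a b n) ⟩
  ψ (a ∘ suc ⊙ b) n + ψ (a ⊙ b ∘ suc) n + fromℕ n * (ψ a ⊙ ψ b) n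
    ≡⟨ cong₂ _+_ (cong₂ _+_ (ψ-⊙ (a ∘ suc) b n) (ψ-⊙ a (b ∘ suc) n)) (euler-⊙ (ψ a) (ψ b) n) ⟩
  (ψ (a ∘ suc) ⊙ ψ b) n + (ψ a ⊙ ψ (b ∘ suc)) n + ((θ a ⊙ ψ b) n + (ψ a ⊙ θ b) n)
    ≡⟨ solve 4 (λ x y z w → (x :+ y) :+ (z :+ w) := (x :+ z) :+ (y :+ w)) refl
         ((ψ (a ∘ suc) ⊙ ψ b) n) ((ψ a ⊙ ψ (b ∘ suc)) n) ((θ a ⊙ ψ b) n) ((ψ a ⊙ θ b) n) ⟩
  ((ψ (a ∘ suc) ⊙ ψ b) n + (θ a ⊙ ψ b) n) + ((ψ a ⊙ ψ (b ∘ suc)) n + (ψ a ⊙ θ b) n)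
    ≡⟨ cong₂ _+_ (⊙-distribʳ-⊕ (ψ b) (ψ (a ∘ suc)) (θ a) n) (⊙-distribˡ-⊕ (ψ a) (ψ (b ∘ suc)) (θ b) n) ⟨
  ((ψ a ∘ suc) ⊙ ψ b) n + (ψ a ⊙ (ψ b ∘ suc)) n ∎
  where
  open ≡-Reasoning
  open ℚ-Solver
  θ : Series → Series
  θ a i = fromℕ i * ψ a i

-- Substitution turns eᵗ into 1 / (1 - y). As E is its own derivative, the recurrence reads wₙ₊₁ =
-- (1 + n) wₙ, and the product with 1 - y telescopes.
ψ-E-inverse : ψ E ⊙ (const 1ℚ ⊕ ⊝ X) ≗ const 1ℚ
ψ-E-inverse n = begin
  (ψ E ⊙ (const 1ℚ ⊕ ⊝ X)) n   ≡⟨ HS.solve 2 (λ w x → w HS.:* (HS.con 1ℚ HS.:- x) HS.:= w HS.:- x HS.:* w) (λ _ → refl) (ψ E) X n ⟩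
  ψ E n - (X ⊙ ψ E) n          ≡⟨ cong (λ x → ψ E n - x) (X-⊙ (ψ E) n) ⟩
  ψ E n - up (ψ E) n           ≡⟨ telescope n ⟩
  const 1ℚ n                   ∎
  where
  open ≡-Reasoning
  module HS = H-Solver
  telescope : ∀ n → ψ E n - up (ψ E) n ≡ const 1ℚ n
  telescope zero    = refl
  telescope (suc n) = begin
    (x + fromℕ n * x) - fromℕ (suc n) * x    ≡⟨ cong (λ y → (x + fromℕ n * x) - y * x) (fromℕ-suc n) ⟩
    (x + fromℕ n * x) - (1ℚ + fromℕ n) * x   ≡⟨ solve 2 (λ x n → (x :+ n :* x) :- (con 1ℚ :+ n) :* x := con 0ℚ) refl x (fromℕ n) ⟩
    0ℚ                                       ∎
    where
    open ℚ-Solver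
    x = ψ E n

-- The recurrence of `ψ` is the Stirling recurrence read on the coefficients of a₀, a₁, .... The
-- bound N is free because the step uses the sum for `a ∘ suc` with bound N and the one for a with
-- bound N + 1; the terms with j > n are zero.
ψ-sum : ∀ a N n → n ℕ.≤ N → ψ a n ≡ ∑[ j ≤ N ] (fromℕ (stirl n (toℕ j)) * a (toℕ j))
ψ-sum a N zero _ = sym (begin
  1ℚ * a 0 + ∑[ j < N ] (0ℚ * a (suc (toℕ j))) ≡⟨ cong₂ _+_ (*-identityˡ (a 0)) (sum-zero N (a ∘ suc)) ⟩
  a 0 + 0ℚ                                      ≡⟨ +-identityʳ (a 0) ⟩
  a 0                                           ∎)
  where
  open ≡-Reasoning
  sum-zero : ∀ N (b : Series) → ∑[ j < N ] (0ℚ * b (toℕ j)) ≡ 0ℚ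
  sum-zero zero    b = refl
  sum-zero (suc N) b = cong₂ _+_ (*-zeroˡ (b 0)) (sum-zero N (b ∘ suc))
ψ-sum a (suc N) (suc n) (s≤s n≤N) = begin
  ψ (a ∘ suc) n + fromℕ n * ψ a n
    ≡⟨ cong₂ (λ x y → x + fromℕ n * y) (ψ-sum (a ∘ suc) N n n≤N) (ψ-sum a (suc N) n (ℕ.m≤n⇒m≤1+n n≤N)) ⟩
  -- The j = 0 term of the second sum is set apart: both remaining sums then run over the same aⱼ₊₁
  -- and merge term by term.
  sum {suc N} u + fromℕ n * (v0 + sum v)
    ≡⟨ solve 4 (λ u c p v → u :+ c :* (p :+ v) := c :* p :+ (u :+ c :* v)) refl (sum u) (fromℕ n) v0 (sum v) ⟩
  fromℕ n * v0 + (sum u + fromℕ n * sum v)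
    ≡⟨ cong (λ x → fromℕ n * v0 + (sum u + x)) (*-distribˡ-sum (CommutativeRing.semiring +-*-commutativeRing) (fromℕ n) v) ⟩
  fromℕ n * v0 + (sum u + ∑[ j ≤ N ] (fromℕ n * v j))
    ≡⟨ cong₂ _+_ (trans (sym (*-assoc (fromℕ n) _ _)) (cong (_* a 0) (sym (fromℕ-* n (stirl n 0)))))
         (sym (∑-distrib-+ +-0-commutativeMonoid u (λ j → fromℕ n * v j))) ⟩
  fromℕ (stirl (suc n) 0) * a 0 + ∑[ j ≤ N ] (u j + fromℕ n * v j)
    ≡⟨ cong (_+_ (fromℕ (stirl (suc n) 0) * a 0)) (sum-cong-≗ {suc N} term) ⟩
  ∑[ j ≤ suc N ] (fromℕ (stirl (suc n) (toℕ j)) * a (toℕ j)) ∎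
  where
  open ≡-Reasoning
  open ℚ-Solver
  u v : Fin.Fin (suc N) → ℚ
  u j = fromℕ (stirl n (toℕ j)) * a (suc (toℕ j))
  v j = fromℕ (stirl n (suc (toℕ j))) * a (suc (toℕ j))
  v0 = fromℕ (stirl n 0) * a 0
  term : (j : Fin.Fin (suc N)) → u j + fromℕ n * v j ≡ fromℕ (stirl (suc n) (suc (toℕ j))) * a (suc (toℕ j))
  term j = begin
    s * c + fromℕ n * (s′ * c)    ≡⟨ solve 4 (λ s c n t → s :* c :+ n :* (t :* c) := (s :+ n :* t) :* c) refl s c (fromℕ n) s′ ⟩
    (s + fromℕ n * s′) * c        ≡⟨ cong (λ x → (s + x) * c) (fromℕ-* n (stirl n (suc (toℕ j)))) ⟨
    (s + fromℕ (n ℕ.* stirl n (suc (toℕ j)))) * c ≡⟨ cong (_* c) (fromℕ-+ (stirl n (toℕ j)) _) ⟨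
    fromℕ (stirl (suc n) (suc (toℕ j))) * c ∎
    where
    s = fromℕ (stirl n (toℕ j))
    s′ = fromℕ (stirl n (suc (toℕ j)))
    c = a (suc (toℕ j))

-- Polynomials as elements of the Hurwitz ring

-- The argument is an arbitrary series because two points matter: `X`, where evaluation is faithful,
-- and `1-X`, which expands a polynomial in powers of y = 1 - x.
ev : Series → Poly → Series
ev z []      = λ _ → 0ℚ
ev z (a ∷ p) = const a ⊕ z ⊙ ev z p

ev-pair : ∀ z a b → ev z (a ∷ b ∷ []) ≗ const a ⊕ z ⊙ const b
ev-pair z a b = H.+-congˡ {const a} (H.*-congˡ {z}
  (H.trans (H.+-congˡ {const b} (H.zeroʳ z)) (H.+-identityʳ (const b))))

ev-+ₚ : ∀ z p q → ev z (p +ₚ q) ≗ ev z p ⊕ ev z q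
ev-+ₚ z []      q       = H.sym (H.+-identityˡ (ev z q))
ev-+ₚ z (a ∷ p) []      = H.sym (H.+-identityʳ (ev z (a ∷ p)))
ev-+ₚ z (a ∷ p) (b ∷ q) = H.begin
  const (a + b) ⊕ z ⊙ ev z (p +ₚ q)
    H.≈⟨ H.+-cong (const-+ a b) (H.*-congˡ {z} (ev-+ₚ z p q)) ⟩
  (const a ⊕ const b) ⊕ z ⊙ (ev z p ⊕ ev z q)
    H.≈⟨ solve 5 (λ a b z p q → (a :+ b) :+ z :* (p :+ q) := (a :+ z :* p) :+ (b :+ z :* q)) (λ _ → refl)
         (const a) (const b) z (ev z p) (ev z q) ⟩
  ev z (a ∷ p) ⊕ ev z (b ∷ q) H.∎
  where open H-Solver

ev-·ₚ : ∀ z c p → ev z (c ·ₚ p) ≗ const c ⊙ ev z p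
ev-·ₚ z c []      = H.sym (H.zeroʳ (const c))
ev-·ₚ z c (a ∷ p) = H.begin
  const (c * a) ⊕ z ⊙ ev z (c ·ₚ p)
    H.≈⟨ H.+-cong (const-* c a) (H.*-congˡ {z} (ev-·ₚ z c p)) ⟩
  const c ⊙ const a ⊕ z ⊙ (const c ⊙ ev z p)
    H.≈⟨ solve 4 (λ c a z p → c :* a :+ z :* (c :* p) := c :* (a :+ z :* p)) (λ _ → refl) (const c) (const a) z (ev z p) ⟩
  const c ⊙ ev z (a ∷ p) H.∎
  where open H-Solver

ev-*ₚ : ∀ z p q → ev z (p *ₚ q) ≗ ev z p ⊙ ev z q
ev-*ₚ z []      q = H.sym (H.zeroˡ (ev z q))
ev-*ₚ z (a ∷ p) q = H.begin
  ev z (a ·ₚ q +ₚ (0ℚ ∷ p *ₚ q))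
    H.≈⟨ ev-+ₚ z (a ·ₚ q) (0ℚ ∷ p *ₚ q) ⟩
  ev z (a ·ₚ q) ⊕ (const 0ℚ ⊕ z ⊙ ev z (p *ₚ q))
    H.≈⟨ H.+-cong (ev-·ₚ z a q) (H.+-congˡ {const 0ℚ} (H.*-congˡ {z} (ev-*ₚ z p q))) ⟩
  const a ⊙ ev z q ⊕ (const 0ℚ ⊕ z ⊙ (ev z p ⊙ ev z q))
    H.≈⟨ solve 4 (λ a z p q → a :* q :+ (con 0ℚ :+ z :* (p :* q)) := (a :+ z :* p) :* q) (λ _ → refl) (const a) z (ev z p) (ev z q) ⟩
  ev z (a ∷ p) ⊙ ev z q H.∎
  where open H-Solver

-- Trailing zeros: in `ev-≈ₚ` one list may end before the other, and the excess must evaluate to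
-- zero.
ev-≈ₚ[] : ∀ z p → p ≈ₚ [] → ev z p ≗ λ _ → 0ℚ
ev-≈ₚ[] z []      _  = λ _ → refl
ev-≈ₚ[] z (a ∷ p) eq = H.begin
  const a ⊕ z ⊙ ev z p          H.≈⟨ H.+-cong (H.trans (const-cong (eq 0)) const-0) (H.*-congˡ {z} (ev-≈ₚ[] z p (eq ∘ suc))) ⟩
  (λ _ → 0ℚ) ⊕ z ⊙ (λ _ → 0ℚ)   H.≈⟨ H.+-identityˡ (z ⊙ (λ _ → 0ℚ)) ⟩
  z ⊙ (λ _ → 0ℚ)                H.≈⟨ H.zeroʳ z ⟩
  (λ _ → 0ℚ)                    H.∎

ev-≈ₚ : ∀ z p q → p ≈ₚ q → ev z p ≗ ev z q
ev-≈ₚ z []      q       eq = H.sym (ev-≈ₚ[] z q (sym ∘ eq))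
ev-≈ₚ z (a ∷ p) []      eq = ev-≈ₚ[] z (a ∷ p) eq
ev-≈ₚ z (a ∷ p) (b ∷ q) eq = H.+-cong (const-cong (eq 0)) (H.*-congˡ {z} (ev-≈ₚ z p q (eq ∘ suc)))

ev-X : ∀ p → ev X p ≗ ordinary (coeff p)
ev-X []      n = sym (*-zeroʳ (fromℕ (n !)))
ev-X (a ∷ p) n = begin
  const a n + (X ⊙ ev X p) n               ≡⟨ cong (_+_ (const a n)) (trans (X-⊙ (ev X p) n) (up-cong (ev-X p) n)) ⟩
  const a n + up (ordinary (coeff p)) n    ≡⟨ ordinary-unfold (coeff (a ∷ p)) n ⟨
  ordinary (coeff (a ∷ p)) n               ∎
  where open ≡-Reasoning

-- Transfers identities found by the solver in the Hurwitz ring back to coefficient lists, so the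
-- lists need no ring laws of their own.
ev-X-injective : ∀ p q → ev X p ≗ ev X q → p ≈ₚ q
ev-X-injective p q eq n = fromℕ-cancelˡ (n !) {{n ℕ.!≢0}}
  (trans (sym (ev-X p n)) (trans (eq n) (ev-X q n)))

-- At z = `1-X`, whose constant term is 1, this produces the value at 1.
ev-0 : ∀ z p → ev z p 0 ≡ eval p (z 0)
ev-0 z []      = refl
ev-0 z (a ∷ p) = cong (λ y → a + z 0 * y) (ev-0 z p)

-- Small multiples of a polynomial

*ₚ-zeroˡ : ∀ h q → h ≈ₚ [] → h *ₚ q ≈ₚ []
*ₚ-zeroˡ h q eq = ev-X-injective (h *ₚ q) []
  (H.trans (ev-*ₚ X h q) (H.trans (H.*-congʳ {ev X q} (ev-≈ₚ[] X h eq)) (H.zeroˡ (ev X q))))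

module _ {q : Poly} {d : ℕ} (q-deg : q HasDegree d) where
  open _HasDegree_ q-deg

  coeff-∷-*ₚ : ∀ a h i → coeff ((a ∷ h) *ₚ q) i ≡ a * coeff q i + coeff (0ℚ ∷ h *ₚ q) i
  coeff-∷-*ₚ a h i = trans (coeff-+ₚ (a ·ₚ q) (0ℚ ∷ h *ₚ q) i) (cong (_+ _) (coeff-·ₚ a q i))

  -- Above degree d the summand a q contributes nothing, so coefficient i + 1 of (a + x h) q is
  -- coefficient i of h q.
  tail-small : ∀ a h → (∀ i → d ℕ.< i → coeff ((a ∷ h) *ₚ q) i ≡ 0ℚ) →
               ∀ i → d ℕ.≤ i → coeff (h *ₚ q) i ≡ 0ℚ
  tail-small a h small i d≤i = begin
    coeff (h *ₚ q) i                          ≡⟨ +-identityˡ _ ⟨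
    0ℚ + coeff (h *ₚ q) i                     ≡⟨ cong (_+ coeff (h *ₚ q) i) (*-zeroʳ a) ⟨
    a * 0ℚ + coeff (h *ₚ q) i                 ≡⟨ cong (λ x → a * x + coeff (h *ₚ q) i) (above≡0 (suc i) (s≤s d≤i)) ⟨
    a * coeff q (suc i) + coeff (h *ₚ q) i    ≡⟨ coeff-∷-*ₚ a h (suc i) ⟨
    coeff ((a ∷ h) *ₚ q) (suc i)              ≡⟨ small (suc i) (s≤s d≤i) ⟩
    0ℚ                                        ∎
    where open ≡-Reasoning

  ∷-*ₚ-scalar : ∀ a h → h ≈ₚ [] → (a ∷ h) *ₚ q ≈ₚ a ·ₚ q
  ∷-*ₚ-scalar a h h≈0 i = begin
    coeff ((a ∷ h) *ₚ q) i                      ≡⟨ coeff-∷-*ₚ a h i ⟩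
    a * coeff q i + coeff (0ℚ ∷ h *ₚ q) i       ≡⟨ cong (_+_ (a * coeff q i)) (shifted i) ⟩
    a * coeff q i + 0ℚ                          ≡⟨ +-identityʳ _ ⟩
    a * coeff q i                               ≡⟨ coeff-·ₚ a q i ⟨
    coeff (a ·ₚ q) i                            ∎
    where
    open ≡-Reasoning
    shifted : ∀ i → coeff (0ℚ ∷ h *ₚ q) i ≡ 0ℚ
    shifted zero    = refl
    shifted (suc i) = *ₚ-zeroˡ h q h≈0 i

  -- Induction from the top of h, without mention of its degree: the tail vanishes first, then the
  -- coefficient at d is a times the leading coefficient of q, which forces a = 0.
  multiple-small⇒≈[] : ∀ h → (∀ i → d ℕ.≤ i → coeff (h *ₚ q) i ≡ 0ℚ) → h ≈ₚ []
  multiple-small⇒≈[] []      small _ = refl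
  multiple-small⇒≈[] (a ∷ h) small = λ { zero → a≡0 ; (suc i) → h≈0 i }
    where
    h≈0 : h ≈ₚ []
    h≈0 = multiple-small⇒≈[] h (tail-small a h (λ i d<i → small i (ℕ.<⇒≤ d<i)))
    instance
      lead-nonZero : NonZero (coeff q d)
      lead-nonZero = ≢-nonZero leading≢0
    a≡0 : a ≡ 0ℚ
    a≡0 = begin
      a                                   ≡⟨ *-identityʳ a ⟨
      a * 1ℚ                              ≡⟨ cong (a *_) (*-inverseʳ (coeff q d)) ⟨
      a * (coeff q d * 1/ coeff q d)      ≡⟨ *-assoc a _ _ ⟨
      a * coeff q d * 1/ coeff q d        ≡⟨ cong (_* 1/ coeff q d) (trans (sym (coeff-·ₚ a q d)) (trans (sym (∷-*ₚ-scalar a h h≈0 d)) (small d ℕ.≤-refl))) ⟩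
      0ℚ * 1/ coeff q d                   ≡⟨ *-zeroˡ (1/ coeff q d) ⟩
      0ℚ                                  ∎
      where open ≡-Reasoning

  multiple-small⇒scalar : ∀ h → (∀ i → d ℕ.< i → coeff (h *ₚ q) i ≡ 0ℚ) → ∃ λ c → h *ₚ q ≈ₚ c ·ₚ q
  multiple-small⇒scalar []      small = 0ℚ , λ i → sym (trans (coeff-·ₚ 0ℚ q i) (*-zeroˡ (coeff q i)))
  multiple-small⇒scalar (a ∷ h) small = a , ∷-*ₚ-scalar a h (multiple-small⇒≈[] h (tail-small a h small))

-- The remainders fₚ m k

-- Telescoping gives (1 - z) ∑ (n + 1 + i) zⁱ = n + Ψ m - (n + m) zᵐ over i < m, and zᵐ = 1 - (1 -
-- z) Ψ m eliminates the power. The start n is general because `weight` raises it along the list;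
-- the derivative is the case n = 0.
weight-Ψ : ∀ z n m → (const 1ℚ ⊕ ⊝ z) ⊙ ev z (weight (suc n) (Ψ m)) ≗
  ⊝ const (fromℕ m) ⊕ ev z (Ψ m) ⊙ (const 1ℚ ⊕ (const (fromℕ n) ⊕ const (fromℕ m)) ⊙ (const 1ℚ ⊕ ⊝ z))
weight-Ψ z n zero = H.begin
  (const 1ℚ ⊕ ⊝ z) ⊙ (λ _ → 0ℚ)     H.≈⟨ H.zeroʳ (const 1ℚ ⊕ ⊝ z) ⟩
  (λ _ → 0ℚ)                        H.≈⟨ H.trans (H.sym const-0) (const-neg 0ℚ) ⟩
  ⊝ const 0ℚ                        H.≈⟨ H.+-identityʳ (⊝ const 0ℚ) ⟨
  ⊝ const 0ℚ ⊕ (λ _ → 0ℚ)           H.≈⟨ H.+-congˡ {⊝ const 0ℚ} (H.zeroˡ Y) ⟨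
  ⊝ const 0ℚ ⊕ (λ _ → 0ℚ) ⊙ Y       H.∎
  where Y = const 1ℚ ⊕ (const (fromℕ n) ⊕ const 0ℚ) ⊙ (const 1ℚ ⊕ ⊝ z)
weight-Ψ z n (suc m) = H.begin
  (const 1ℚ ⊕ ⊝ z) ⊙ (const (fromℕ (suc n) * 1ℚ) ⊕ z ⊙ W)
    H.≈⟨ H.*-congˡ {const 1ℚ ⊕ ⊝ z} (H.+-congʳ (H.trans (const-cong (*-identityʳ (fromℕ (suc n)))) (const-fromℕ-suc n))) ⟩
  (const 1ℚ ⊕ ⊝ z) ⊙ ((const 1ℚ ⊕ N) ⊕ z ⊙ W)
    H.≈⟨ solve 3 (λ n z w → (con 1ℚ :- z) :* ((con 1ℚ :+ n) :+ z :* w) :=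
                            (con 1ℚ :- z) :* (con 1ℚ :+ n) :+ z :* ((con 1ℚ :- z) :* w)) (λ _ → refl) N z W ⟩
  (const 1ℚ ⊕ ⊝ z) ⊙ (const 1ℚ ⊕ N) ⊕ z ⊙ ((const 1ℚ ⊕ ⊝ z) ⊙ W)
    H.≈⟨ H.+-congˡ {(const 1ℚ ⊕ ⊝ z) ⊙ (const 1ℚ ⊕ N)} (H.*-congˡ {z} (H.trans (weight-Ψ z (suc n) m)
         (H.+-congˡ {⊝ M} (H.*-congˡ {P} (H.+-congˡ {const 1ℚ} (H.*-congʳ (H.+-congʳ (const-fromℕ-suc n)))))))) ⟩
  (const 1ℚ ⊕ ⊝ z) ⊙ (const 1ℚ ⊕ N) ⊕ z ⊙ (⊝ M ⊕ P ⊙ (const 1ℚ ⊕ ((const 1ℚ ⊕ N) ⊕ M) ⊙ (const 1ℚ ⊕ ⊝ z)))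
    H.≈⟨ solve 4 (λ z n m p →
           (con 1ℚ :- z) :* (con 1ℚ :+ n) :+ z :* ((:- m) :+ p :* (con 1ℚ :+ ((con 1ℚ :+ n) :+ m) :* (con 1ℚ :- z))) :=
           (:- (con 1ℚ :+ m)) :+ (con 1ℚ :+ z :* p) :* (con 1ℚ :+ (n :+ (con 1ℚ :+ m)) :* (con 1ℚ :- z))) (λ _ → refl) z N M P ⟩
  ⊝ (const 1ℚ ⊕ M) ⊕ (const 1ℚ ⊕ z ⊙ P) ⊙ (const 1ℚ ⊕ (N ⊕ (const 1ℚ ⊕ M)) ⊙ (const 1ℚ ⊕ ⊝ z))
    H.≈⟨ H.+-cong (H.-‿cong (const-fromℕ-suc m)) (H.*-congˡ {const 1ℚ ⊕ z ⊙ P} (H.+-congˡ {const 1ℚ} (H.*-congʳ (H.+-congˡ {N} (const-fromℕ-suc m))))) ⟨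
  ⊝ const (fromℕ (suc m)) ⊕ ev z (Ψ (suc m)) ⊙ (const 1ℚ ⊕ (N ⊕ const (fromℕ (suc m))) ⊙ (const 1ℚ ⊕ ⊝ z)) H.∎
  where
  open H-Solver
  N = const (fromℕ n)
  M = const (fromℕ m)
  P = ev z (Ψ m)
  W = ev z (weight (suc (suc n)) (Ψ m))

module _ (m-2 : ℕ) where

  private
    m = suc (suc m-2)

  base : Poly
  base = (- (+ 1 / m)) ·ₚ (Xₚ *ₚ deriv (Ψ m))

  -- Found by solving for it: apply `weight-Ψ` in (1 - z) times `base` and replace z Ψ (m - 1) by Ψ
  -- m - 1; the factor collected at - Ψ m is 1 - ((m - 1) / m) z.
  cofactor : Poly
  cofactor = 1ℚ ∷ - ((+ 1 / m) * fromℕ (suc m-2)) ∷ []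

  base-inverse : ∀ z → (const 1ℚ ⊕ ⊝ z) ⊙ ev z base ≗ const 1ℚ ⊕ ⊝ (ev z cofactor ⊙ ev z (Ψ m))
  base-inverse z = H.begin
    D ⊙ ev z base
      H.≈⟨ H.*-congˡ {D} ev-base ⟩
    D ⊙ (⊝ R ⊙ (z ⊙ W))
      H.≈⟨ solve 4 (λ d r z w → d :* ((:- r) :* (z :* w)) := (:- r) :* (z :* (d :* w))) (λ _ → refl) D R z W ⟩
    ⊝ R ⊙ (z ⊙ (D ⊙ W))
      H.≈⟨ H.*-congˡ {⊝ R} (H.*-congˡ {z} (weight-Ψ z 0 (suc m-2))) ⟩
    ⊝ R ⊙ (z ⊙ (⊝ M ⊕ P ⊙ (const 1ℚ ⊕ (const 0ℚ ⊕ M) ⊙ D)))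
      -- Here m stands for the predecessor of the modulus index. The solver cannot know r (1 + m) =
      -- 1, so this product takes the place of 1 until `unit` removes it.
      H.≈⟨ solve 4 (λ r z m p →
             (:- r) :* (z :* ((:- m) :+ p :* (con 1ℚ :+ (con 0ℚ :+ m) :* (con 1ℚ :- z)))) :=
             r :* (con 1ℚ :+ m) :- (r :* (con 1ℚ :+ m) :+ z :* (:- (r :* m))) :* (con 1ℚ :+ z :* p)) (λ _ → refl) R z M P ⟩
    R ⊙ (const 1ℚ ⊕ M) ⊕ ⊝ ((R ⊙ (const 1ℚ ⊕ M) ⊕ z ⊙ ⊝ (R ⊙ M)) ⊙ (const 1ℚ ⊕ z ⊙ P))
      H.≈⟨ H.+-cong unit (H.-‿cong (H.*-congʳ {ev z (Ψ m)} (H.+-congʳ unit))) ⟩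
    const 1ℚ ⊕ ⊝ ((const 1ℚ ⊕ z ⊙ ⊝ (R ⊙ M)) ⊙ ev z (Ψ m))
      H.≈⟨ H.+-congˡ {const 1ℚ} (H.-‿cong (H.*-congʳ {ev z (Ψ m)} ev-cofactor)) ⟨
    const 1ℚ ⊕ ⊝ (ev z cofactor ⊙ ev z (Ψ m)) H.∎
    where
    open H-Solver
    D = const 1ℚ ⊕ ⊝ z
    R = const (+ 1 / m)
    M = const (fromℕ (suc m-2))
    P = ev z (Ψ (suc m-2))
    W = ev z (deriv (Ψ m))
    ev-base : ev z base ≗ ⊝ R ⊙ (z ⊙ W)
    ev-base = H.begin
      ev z base
        H.≈⟨ ev-·ₚ z (- (+ 1 / m)) (Xₚ *ₚ deriv (Ψ m)) ⟩
      const (- (+ 1 / m)) ⊙ ev z (Xₚ *ₚ deriv (Ψ m))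
        H.≈⟨ H.*-cong (const-neg (+ 1 / m)) (ev-*ₚ z Xₚ (deriv (Ψ m))) ⟩
      ⊝ R ⊙ (ev z Xₚ ⊙ W)
        H.≈⟨ H.*-congˡ {⊝ R} (H.*-congʳ {W} (H.trans (ev-pair z 0ℚ 1ℚ)
               (solve 1 (λ z → con 0ℚ :+ z :* con 1ℚ := z) (λ _ → refl) z))) ⟩
      ⊝ R ⊙ (z ⊙ W) H.∎
    ev-cofactor : ev z cofactor ≗ const 1ℚ ⊕ z ⊙ ⊝ (R ⊙ M)
    ev-cofactor = H.trans (ev-pair z 1ℚ (- ((+ 1 / m) * fromℕ (suc m-2))))
      (H.+-congˡ {const 1ℚ} (H.*-congˡ {z} (H.trans (const-neg ((+ 1 / m) * fromℕ (suc m-2)))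
        (H.-‿cong (const-* (+ 1 / m) (fromℕ (suc m-2)))))))
    unit : R ⊙ (const 1ℚ ⊕ M) ≗ const 1ℚ
    unit = H.begin
      R ⊙ (const 1ℚ ⊕ M)              H.≈⟨ H.*-congˡ {R} (const-fromℕ-suc (suc m-2)) ⟨
      R ⊙ const (fromℕ m)             H.≈⟨ const-* (+ 1 / m) (fromℕ m) ⟨
      const ((+ 1 / m) * fromℕ m)     H.≈⟨ const-cong (*-inverse-fromℕ m) ⟩
      const 1ℚ                        H.∎

  private
    module Div (k : ℕ) = DivMod (divMod (base ^ₚ k) (Ψ m) Ψ-degree)

  ev-division : ∀ z k → ev z (base ^ₚ k) ≗ ev z (Div.quotient k) ⊙ ev z (Ψ m) ⊕ ev z (fₚ m k)
  ev-division z k = H.trans (ev-≈ₚ z (base ^ₚ k) (Div.quotient k *ₚ Ψ m +ₚ fₚ m k) (Div.property k))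
    (H.trans (ev-+ₚ z (Div.quotient k *ₚ Ψ m) (fₚ m k)) (H.+-congʳ (ev-*ₚ z (Div.quotient k) (Ψ m))))

  ev-remainder : ∀ z k → ev z (fₚ m k) ≗ ev z (base ^ₚ k) ⊕ ⊝ (ev z (Div.quotient k) ⊙ ev z (Ψ m))
  ev-remainder z k = H.trans (solve 2 (λ s f → f := (s :+ f) :- s) (λ _ → refl) (ev z (Div.quotient k) ⊙ ev z (Ψ m)) (ev z (fₚ m k)))
    (H.+-congʳ (H.sym (ev-division z k)))
    where open H-Solver

  f-zero : ∀ z → ev z (fₚ m 0) ≗ const 1ℚ
  f-zero z = H.begin
    ev z (fₚ m 0)
      H.≈⟨ ev-remainder z 0 ⟩
    ev z (1ℚ ∷ []) ⊕ ⊝ (ev z (Div.quotient 0) ⊙ ev z (Ψ m))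
      H.≈⟨ H.+-cong (H.trans (H.+-congˡ {const 1ℚ} (H.zeroʳ z)) (H.+-identityʳ (const 1ℚ)))
             (H.-‿cong (H.*-congʳ {ev z (Ψ m)} (H.trans (ev-≈ₚ[] z (Div.quotient 0) quotient≈0) (H.sym const-0)))) ⟩
    const 1ℚ ⊕ ⊝ (const 0ℚ ⊙ ev z (Ψ m))
      H.≈⟨ solve 1 (λ p → con 1ℚ :- con 0ℚ :* p := con 1ℚ) (λ _ → refl) (ev z (Ψ m)) ⟩
    const 1ℚ H.∎
    where
    open H-Solver
    quotient≈0 : Div.quotient 0 ≈ₚ []
    quotient≈0 = multiple-small⇒≈[] (Ψ-degree {suc m-2}) (Div.quotient 0) small
      where
      small : ∀ i → suc m-2 ℕ.≤ i → coeff (Div.quotient 0 *ₚ Ψ m) i ≡ 0ℚ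
      -- Since m - 1 ≥ 1, only positive indices occur, and there the constant polynomial 1 has
      -- coefficient 0.
      small (suc i) m-1≤i = begin
        x                ≡⟨ +-identityʳ x ⟨
        x + 0ℚ           ≡⟨ cong (_+_ x) (Div.remainder-degree 0 (suc i) m-1≤i) ⟨
        x + coeff (fₚ m 0) (suc i)  ≡⟨ coeff-+ₚ (Div.quotient 0 *ₚ Ψ m) (fₚ m 0) (suc i) ⟨
        coeff (Div.quotient 0 *ₚ Ψ m +ₚ fₚ m 0) (suc i)  ≡⟨ Div.property 0 (suc i) ⟨
        0ℚ               ∎
        where
        open ≡-Reasoning
        x = coeff (Div.quotient 0 *ₚ Ψ m) (suc i)

  -- One scalar serves every z, because the relation is proved between polynomials and then
  -- evaluated. Its value is left open here; `c-value` reads it off at the point 1.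
  f-suc : ∀ k → ∃ λ c → ∀ z → (const 1ℚ ⊕ ⊝ z) ⊙ ev z (fₚ m (suc k)) ⊕ ⊝ ev z (fₚ m k) ≗ const c ⊙ ev z (Ψ m)
  f-suc k = c , λ z → H.begin
    (const 1ℚ ⊕ ⊝ z) ⊙ ev z (fₚ m (suc k)) ⊕ ⊝ ev z (fₚ m k)   H.≈⟨ ev-p z ⟨
    ev z p                    H.≈⟨ ev-≈ₚ z p (c ·ₚ Ψ m) (λ i → trans (p≈hΨ i) (hΨ≈cΨ i)) ⟩
    ev z (c ·ₚ Ψ m)           H.≈⟨ ev-·ₚ z c (Ψ m) ⟩
    const c ⊙ ev z (Ψ m)      H.∎
    where
    open H-Solver
    1-x = 1ℚ ∷ - 1ℚ ∷ []
    s = Div.quotient k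
    s′ = Div.quotient (suc k)
    f = fₚ m k
    f′ = fₚ m (suc k)
    p = 1-x *ₚ f′ +ₚ (- 1ℚ) ·ₚ f
    -- With g = `base`, u = `cofactor`, gᵏ = s Ψ + f, gᵏ⁺¹ = s′ Ψ + f′ and (1 - x) g = 1 - u Ψ, the
    -- gᵏ cancel in (1 - x) f′ - f, leaving (s - u gᵏ - (1 - x) s′) Ψ.
    h = s +ₚ (- 1ℚ) ·ₚ (cofactor *ₚ base ^ₚ k +ₚ 1-x *ₚ s′)

    ev-1-x : ∀ z → ev z 1-x ≗ const 1ℚ ⊕ ⊝ z
    ev-1-x z = H.trans (ev-pair z 1ℚ (- 1ℚ)) (solve 1 (λ z → con 1ℚ :+ z :* con (- 1ℚ) := con 1ℚ :- z) (λ _ → refl) z)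

    ev-p : ∀ z → ev z p ≗ (const 1ℚ ⊕ ⊝ z) ⊙ ev z f′ ⊕ ⊝ ev z f
    ev-p z = H.trans (ev-+ₚ z (1-x *ₚ f′) ((- 1ℚ) ·ₚ f)) (H.+-cong
      (H.trans (ev-*ₚ z 1-x f′) (H.*-congʳ {ev z f′} (ev-1-x z)))
      (H.trans (ev-·ₚ z (- 1ℚ) f) (solve 1 (λ x → con (- 1ℚ) :* x := :- x) (λ _ → refl) (ev z f))))

    ev-h : ∀ z → ev z h ≗ ev z s ⊕ ⊝ (ev z cofactor ⊙ ev z (base ^ₚ k) ⊕ (const 1ℚ ⊕ ⊝ z) ⊙ ev z s′)
    ev-h z = H.trans (ev-+ₚ z s ((- 1ℚ) ·ₚ t)) (H.+-congˡ {ev z s} (H.trans (ev-·ₚ z (- 1ℚ) t)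
      (H.trans (solve 1 (λ x → con (- 1ℚ) :* x := :- x) (λ _ → refl) (ev z t))
      (H.-‿cong (H.trans (ev-+ₚ z (cofactor *ₚ base ^ₚ k) (1-x *ₚ s′))
        (H.+-cong (ev-*ₚ z cofactor (base ^ₚ k)) (H.trans (ev-*ₚ z 1-x s′) (H.*-congʳ {ev z s′} (ev-1-x z)))))))))
      where t = cofactor *ₚ base ^ₚ k +ₚ 1-x *ₚ s′

    p≈hΨ : p ≈ₚ h *ₚ Ψ m
    p≈hΨ = ev-X-injective p (h *ₚ Ψ m) (H.begin
      ev X p
        H.≈⟨ ev-p X ⟩
      D ⊙ ev X f′ ⊕ ⊝ ev X f
        H.≈⟨ H.+-cong (H.*-congˡ {D} (H.trans (ev-remainder X (suc k)) (H.+-congʳ (ev-*ₚ X base (base ^ₚ k)))))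
                      (H.-‿cong (ev-remainder X k)) ⟩
      D ⊙ (g ⊙ gᵏ ⊕ ⊝ (S′ ⊙ P)) ⊕ ⊝ (gᵏ ⊕ ⊝ (S ⊙ P))
        H.≈⟨ solve 6 (λ d g gᵏ s s′ p → d :* (g :* gᵏ :- s′ :* p) :- (gᵏ :- s :* p) :=
                                        (d :* g) :* gᵏ :- gᵏ :+ (s :- d :* s′) :* p) (λ _ → refl) D g gᵏ S S′ P ⟩
      (D ⊙ g) ⊙ gᵏ ⊕ ⊝ gᵏ ⊕ (S ⊕ ⊝ (D ⊙ S′)) ⊙ P
        H.≈⟨ H.+-congʳ (H.+-congʳ (H.*-congʳ {gᵏ} (base-inverse X))) ⟩
      (const 1ℚ ⊕ ⊝ (U ⊙ P)) ⊙ gᵏ ⊕ ⊝ gᵏ ⊕ (S ⊕ ⊝ (D ⊙ S′)) ⊙ P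
        H.≈⟨ solve 6 (λ d u gᵏ s s′ p → (con 1ℚ :- u :* p) :* gᵏ :- gᵏ :+ (s :- d :* s′) :* p :=
                                        (s :- (u :* gᵏ :+ d :* s′)) :* p) (λ _ → refl) D U gᵏ S S′ P ⟩
      (S ⊕ ⊝ (U ⊙ gᵏ ⊕ D ⊙ S′)) ⊙ P
        H.≈⟨ H.trans (ev-*ₚ X h (Ψ m)) (H.*-congʳ {P} (ev-h X)) ⟨
      ev X (h *ₚ Ψ m) H.∎)
      where
      D = const 1ℚ ⊕ ⊝ X
      g = ev X base
      gᵏ = ev X (base ^ₚ k)
      U = ev X cofactor
      S = ev X s
      S′ = ev X s′
      P = ev X (Ψ m)

    p-small : ∀ i → suc m-2 ℕ.< i → coeff p i ≡ 0ℚ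
    p-small (suc i) (s≤s m-1≤i) = begin
      coeff p (suc i)
        ≡⟨ coeff-+ₚ (1-x *ₚ f′) ((- 1ℚ) ·ₚ f) (suc i) ⟩
      coeff (1-x *ₚ f′) (suc i) + coeff ((- 1ℚ) ·ₚ f) (suc i)
        ≡⟨ cong₂ _+_ (coeff-1-x f′ i) (coeff-·ₚ (- 1ℚ) f (suc i)) ⟩
      (1ℚ * coeff f′ (suc i) + - 1ℚ * coeff f′ i) + - 1ℚ * coeff f (suc i)
        ≡⟨ cong₂ (λ x y → x + - 1ℚ * y)
             (cong₂ (λ x y → 1ℚ * x + - 1ℚ * y) (Div.remainder-degree (suc k) (suc i) (ℕ.m≤n⇒m≤1+n m-1≤i))
                                                (Div.remainder-degree (suc k) i m-1≤i))
             (Div.remainder-degree k (suc i) (ℕ.m≤n⇒m≤1+n m-1≤i)) ⟩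
      0ℚ ∎
      where
      open ≡-Reasoning
      coeff-1-x : ∀ q i → coeff (1-x *ₚ q) (suc i) ≡ 1ℚ * coeff q (suc i) + - 1ℚ * coeff q i
      coeff-1-x q i = trans (coeff-+ₚ (1ℚ ·ₚ q) (0ℚ ∷ (- 1ℚ ∷ []) *ₚ q) (suc i)) (cong₂ _+_ (coeff-·ₚ 1ℚ q (suc i))
        (trans (coeff-+ₚ (- 1ℚ ·ₚ q) (0ℚ ∷ []) i) (trans (cong₂ _+_ (coeff-·ₚ (- 1ℚ) q i) (coeff-0 i)) (+-identityʳ _))))
        where
        coeff-0 : ∀ i → coeff (0ℚ ∷ []) i ≡ 0ℚ
        coeff-0 zero    = refl
        coeff-0 (suc i) = refl

    scalar = multiple-small⇒scalar (Ψ-degree {suc m-2}) h (λ i d<i → trans (sym (p≈hΨ i)) (p-small i d<i))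
    c = proj₁ scalar
    hΨ≈cΨ = proj₂ scalar

-- The values fₚ m k at 1

1-X : Series
1-X = const 1ℚ ⊕ ⊝ X

-- The geometric sum y Ψ m (1 - y) = 1 - (1 - y)ᵐ, multiplied by (1 - y)⁻ᵐ, which is what `ψ` makes
-- of eᵐᵗ. In this form no e⁻ᵐᵗ is needed.
Ψ-geometric : ∀ m → ψ (dilate m E) ⊙ (X ⊙ ev 1-X (Ψ m)) ≗ ψ (dilate m E) ⊕ ⊝ const 1ℚ
Ψ-geometric zero = H.begin
  ψ (dilate 0 E) ⊙ (X ⊙ (λ _ → 0ℚ))  H.≈⟨ H.*-congˡ {ψ (dilate 0 E)} (H.zeroʳ X) ⟩
  ψ (dilate 0 E) ⊙ (λ _ → 0ℚ)        H.≈⟨ H.zeroʳ (ψ (dilate 0 E)) ⟩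
  (λ _ → 0ℚ)                         H.≈⟨ H.-‿inverseʳ (const 1ℚ) ⟨
  const 1ℚ ⊕ ⊝ const 1ℚ              H.≈⟨ H.+-congʳ (H.trans (ψ-cong dilate-0) (ψ-const 1ℚ)) ⟨
  ψ (dilate 0 E) ⊕ ⊝ const 1ℚ        H.∎
  where
  dilate-0 : dilate 0 E ≗ const 1ℚ
  dilate-0 zero    = refl
  dilate-0 (suc n) = refl
Ψ-geometric (suc m) = H.begin
  ψ (dilate (suc m) E) ⊙ (X ⊙ (const 1ℚ ⊕ 1-X ⊙ P))
    H.≈⟨ H.*-congʳ {X ⊙ (const 1ℚ ⊕ 1-X ⊙ P)} ψ-suc ⟩
  (ψ E ⊙ W) ⊙ (X ⊙ (const 1ℚ ⊕ 1-X ⊙ P))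
    H.≈⟨ solve 4 (λ w W x p → (w :* W) :* (x :* (con 1ℚ :+ (con 1ℚ :- x) :* p)) :=
                              w :* W :* x :+ (w :* (con 1ℚ :- x)) :* (W :* (x :* p))) (λ _ → refl) (ψ E) W X P ⟩
  ψ E ⊙ W ⊙ X ⊕ (ψ E ⊙ 1-X) ⊙ (W ⊙ (X ⊙ P))
    H.≈⟨ H.+-congˡ {ψ E ⊙ W ⊙ X} (H.*-cong ψ-E-inverse (Ψ-geometric m)) ⟩
  ψ E ⊙ W ⊙ X ⊕ const 1ℚ ⊙ (W ⊕ ⊝ const 1ℚ)
    H.≈⟨ solve 3 (λ w W x → w :* W :* x :+ con 1ℚ :* (W :- con 1ℚ) := w :* W :* x :+ con 1ℚ :* W :- con 1ℚ) (λ _ → refl) (ψ E) W X ⟩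
  ψ E ⊙ W ⊙ X ⊕ const 1ℚ ⊙ W ⊕ ⊝ const 1ℚ
    -- The unit is expanded again, so that w W x and w W (1 - x) add up to w W.
    H.≈⟨ H.+-congʳ (H.+-congˡ {ψ E ⊙ W ⊙ X} (H.*-congʳ {W} ψ-E-inverse)) ⟨
  ψ E ⊙ W ⊙ X ⊕ ψ E ⊙ 1-X ⊙ W ⊕ ⊝ const 1ℚ
    H.≈⟨ solve 3 (λ w W x → w :* W :* x :+ w :* (con 1ℚ :- x) :* W :- con 1ℚ := w :* W :- con 1ℚ) (λ _ → refl) (ψ E) W X ⟩
  ψ E ⊙ W ⊕ ⊝ const 1ℚ
    H.≈⟨ H.+-congʳ ψ-suc ⟨
  ψ (dilate (suc m) E) ⊕ ⊝ const 1ℚ H.∎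
  where
  open H-Solver
  P = ev 1-X (Ψ m)
  W = ψ (dilate m E)
  ψ-suc : ψ (dilate (suc m) E) ≗ ψ E ⊙ W
  ψ-suc = H.trans (ψ-cong (dilate-suc-E m)) (ψ-⊙ E (dilate m E))

-- The series (β(mt) - β(t)) / t: the constant terms cancel, and division by t shifts the index and
-- divides by it. Index i carries the summand j = i + 1 of the theorem.
Q : ℕ → Series
Q m i = β (suc i) * (+ 1 / suc i) * (fromℕ (m ℕ.^ suc i) - 1ℚ)

X-Q : ∀ m → X ⊙ Q m ≗ dilate m β ⊕ ⊝ β
X-Q m zero    = *-zeroˡ (Q m 0)
X-Q m (suc n) = begin
  (X ⊙ Q m) (suc n)                  ≡⟨ X-⊙ (Q m) (suc n) ⟩
  N * (b * (+ 1 / suc n) * (p - 1ℚ)) ≡⟨ solve 4 (λ n b r p → n :* (b :* r :* (p :- con 1ℚ)) := (r :* n) :* (p :* b :- b)) refl N b (+ 1 / suc n) p ⟩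
  (+ 1 / suc n) * N * (p * b - b)    ≡⟨ cong (_* (p * b - b)) (*-inverse-fromℕ (suc n)) ⟩
  1ℚ * (p * b - b)                   ≡⟨ *-identityˡ _ ⟩
  p * b - b                          ∎
  where
  open ≡-Reasoning
  open ℚ-Solver
  N = fromℕ (suc n)
  b = β (suc n)
  p = fromℕ (m ℕ.^ suc n)

-- With P = Ψ m (1 - y), this is m / P = 1 + y ψ(Q m): put y = 1 - e⁻ᵗ, so that
-- y = t / β(t) and m / P = m y / (1 - e⁻ᵐᵗ) = β(mt) / β(t).

generating-function : ∀ m → (const 1ℚ ⊕ X ⊙ ψ (Q m)) ⊙ ev 1-X (Ψ m) ≗ const (fromℕ m)
generating-function m = X-cancelˡ (Z ⊙ P) M (H.begin
  X ⊙ (Z ⊙ P)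
    -- `W-L-Z-P` yields Z P = M only up to the factors W and L. W has the inverse V, whereas L = -
    -- log (1 - y) is no unit; but it divides y, so y is written as a multiple of L, and y can be
    -- cancelled.
    H.≈⟨ H.*-congʳ {Z ⊙ P} L-factor ⟨
  (1-X ⊙ (ψ ε ⊙ L)) ⊙ (Z ⊙ P)
    H.≈⟨ solve 5 (λ v e l z p → (v :* (e :* l)) :* (z :* p) := con 1ℚ :* (v :* e :* (l :* z :* p))) (λ _ → refl) 1-X (ψ ε) L Z P ⟩
  const 1ℚ ⊙ (1-X ⊙ ψ ε ⊙ (L ⊙ Z ⊙ P))
    H.≈⟨ H.*-congʳ {1-X ⊙ ψ ε ⊙ (L ⊙ Z ⊙ P)} V-W ⟨
  (V ⊙ W) ⊙ (1-X ⊙ ψ ε ⊙ (L ⊙ Z ⊙ P))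
    H.≈⟨ solve 4 (λ v w c r → (v :* w) :* (c :* r) := (v :* c) :* (w :* r)) (λ _ → refl) V W (1-X ⊙ ψ ε) (L ⊙ Z ⊙ P) ⟩
  (V ⊙ (1-X ⊙ ψ ε)) ⊙ (W ⊙ (L ⊙ Z ⊙ P))
    H.≈⟨ H.*-congˡ {V ⊙ (1-X ⊙ ψ ε)} W-L-Z-P ⟩
  (V ⊙ (1-X ⊙ ψ ε)) ⊙ (M ⊙ L ⊙ W)
    H.≈⟨ solve 6 (λ v x e m l w → (v :* (x :* e)) :* (m :* l :* w) := (v :* w) :* ((x :* (e :* l)) :* m)) (λ _ → refl) V 1-X (ψ ε) M L W ⟩
  (V ⊙ W) ⊙ ((1-X ⊙ (ψ ε ⊙ L)) ⊙ M)
    H.≈⟨ H.*-cong V-W (H.*-congʳ {M} L-factor) ⟩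
  const 1ℚ ⊙ (X ⊙ M)
    H.≈⟨ H.*-identityˡ (X ⊙ M) ⟩
  X ⊙ M H.∎)
  where
  open H-Solver
  Z = const 1ℚ ⊕ X ⊙ ψ (Q m)
  P = ev 1-X (Ψ m)
  M = const (fromℕ m)
  L = ψ X
  W = ψ (dilate m E)
  -- This is (1 - y)ᵐ.
  V = const 1ℚ ⊕ ⊝ (X ⊙ P)
  B = ψ β
  Bₘ = ψ (dilate m β)

  ψ-sub-1 : ∀ a → ψ (a ⊕ ⊝ const 1ℚ) ≗ ψ a ⊕ ⊝ const 1ℚ
  ψ-sub-1 a = H.trans (ψ-⊕ a (⊝ const 1ℚ)) (H.+-congˡ {ψ a} (H.trans (ψ-⊝ (const 1ℚ)) (H.-‿cong (ψ-const 1ℚ))))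

  -- The series (eᵗ - 1) / t; after substitution, L times it is y / (1 - y).
  ε : Series
  ε n = + 1 / suc n

  X-ε : X ⊙ ε ≗ E ⊕ ⊝ const 1ℚ
  X-ε n = trans (X-⊙ ε n) (lemma n)
    where
    lemma : up ε ≗ E ⊕ ⊝ const 1ℚ
    lemma zero    = refl
    lemma (suc n) = trans (*-comm (fromℕ (suc n)) (ε n)) (*-inverse-fromℕ (suc n))

  L-factor : 1-X ⊙ (ψ ε ⊙ L) ≗ X
  L-factor = H.begin
    1-X ⊙ (ψ ε ⊙ L)              H.≈⟨ H.*-congˡ {1-X} (H.trans (H.*-comm (ψ ε) L) (H.trans (H.sym (ψ-⊙ X ε)) (H.trans (ψ-cong X-ε) (ψ-sub-1 E)))) ⟩
    1-X ⊙ (ψ E ⊕ ⊝ const 1ℚ)     H.≈⟨ solve 2 (λ v w → v :* (w :- con 1ℚ) := w :* v :- v) (λ _ → refl) 1-X (ψ E) ⟩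
    ψ E ⊙ 1-X ⊕ ⊝ 1-X            H.≈⟨ H.+-congʳ ψ-E-inverse ⟩
    const 1ℚ ⊕ ⊝ 1-X             H.≈⟨ solve 1 (λ x → con 1ℚ :- (con 1ℚ :- x) := x) (λ _ → refl) X ⟩
    X                            H.∎

  V-W : V ⊙ W ≗ const 1ℚ
  V-W = H.begin
    V ⊙ W                        H.≈⟨ solve 2 (λ w q → (con 1ℚ :- q) :* w := w :- w :* q) (λ _ → refl) W (X ⊙ P) ⟩
    W ⊕ ⊝ (W ⊙ (X ⊙ P))          H.≈⟨ H.+-congˡ {W} (H.-‿cong (Ψ-geometric m)) ⟩
    W ⊕ ⊝ (W ⊕ ⊝ const 1ℚ)       H.≈⟨ solve 1 (λ w → w :- (w :- con 1ℚ) := con 1ℚ) (λ _ → refl) W ⟩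
    const 1ℚ                     H.∎

  B-X : B ⊙ X ≗ L
  B-X = H.begin
    B ⊙ X                                     H.≈⟨ solve 2 (λ b x → b :* x := b :* (con 1ℚ :- (con 1ℚ :- x))) (λ _ → refl) B X ⟩
    B ⊙ (const 1ℚ ⊕ ⊝ 1-X)                    H.≈⟨ H.*-congˡ {B} (H.+-congʳ ψ-E-inverse) ⟨
    B ⊙ (ψ E ⊙ 1-X ⊕ ⊝ 1-X)                   H.≈⟨ solve 3 (λ b w v → b :* (w :* v :- v) := b :* (w :- con 1ℚ) :* v) (λ _ → refl) B (ψ E) 1-X ⟩
    B ⊙ (ψ E ⊕ ⊝ const 1ℚ) ⊙ 1-X              H.≈⟨ H.*-congʳ {1-X} (H.trans (H.*-congˡ {B} (H.sym (ψ-sub-1 E)))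
                                                   (H.trans (H.sym (ψ-⊙ β (E ⊕ ⊝ const 1ℚ))) (H.trans (ψ-cong β-E) (ψ-⊙ X E)))) ⟩
    L ⊙ ψ E ⊙ 1-X                             H.≈⟨ H.*-assoc L (ψ E) 1-X ⟩
    L ⊙ (ψ E ⊙ 1-X)                           H.≈⟨ H.*-congˡ {L} ψ-E-inverse ⟩
    L ⊙ const 1ℚ                              H.≈⟨ H.*-identityʳ L ⟩
    L                                         H.∎

  Bₘ-W : Bₘ ⊙ (W ⊕ ⊝ const 1ℚ) ≗ M ⊙ L ⊙ W
  Bₘ-W = H.begin
    Bₘ ⊙ (W ⊕ ⊝ const 1ℚ)                         H.≈⟨ H.*-congˡ {Bₘ} (ψ-sub-1 (dilate m E)) ⟨
    Bₘ ⊙ ψ (dilate m E ⊕ ⊝ const 1ℚ)              H.≈⟨ ψ-⊙ (dilate m β) (dilate m E ⊕ ⊝ const 1ℚ) ⟨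
    ψ (dilate m β ⊙ (dilate m E ⊕ ⊝ const 1ℚ))    H.≈⟨ ψ-cong dilated ⟩
    ψ (M ⊙ X ⊙ dilate m E)                        H.≈⟨ ψ-⊙ (M ⊙ X) (dilate m E) ⟩
    ψ (M ⊙ X) ⊙ W                                 H.≈⟨ H.*-congʳ {W} (H.trans (ψ-⊙ M X) (H.*-congʳ {L} (ψ-const (fromℕ m)))) ⟩
    M ⊙ L ⊙ W                                     H.∎
    where
    dilated : dilate m β ⊙ (dilate m E ⊕ ⊝ const 1ℚ) ≗ M ⊙ X ⊙ dilate m E
    dilated = H.begin
      dilate m β ⊙ (dilate m E ⊕ ⊝ const 1ℚ)             H.≈⟨ H.*-congˡ {dilate m β} (H.+-congˡ {dilate m E} (H.-‿cong (dilate-const m 1ℚ))) ⟨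
      dilate m β ⊙ (dilate m E ⊕ ⊝ dilate m (const 1ℚ))  H.≈⟨ H.*-congˡ {dilate m β} (dilate-sub m E (const 1ℚ)) ⟨
      dilate m β ⊙ dilate m (E ⊕ ⊝ const 1ℚ)             H.≈⟨ dilate-⊙ m β (E ⊕ ⊝ const 1ℚ) ⟨
      dilate m (β ⊙ (E ⊕ ⊝ const 1ℚ))                    H.≈⟨ dilate-cong m β-E ⟩
      dilate m (X ⊙ E)                                   H.≈⟨ dilate-⊙ m X E ⟩
      dilate m X ⊙ dilate m E                            H.≈⟨ H.*-congʳ {dilate m E} (dilate-X m) ⟩
      M ⊙ X ⊙ dilate m E                                 H.∎

  L-ψQ : L ⊙ ψ (Q m) ≗ Bₘ ⊕ ⊝ B
  L-ψQ = H.begin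
    L ⊙ ψ (Q m)                  H.≈⟨ ψ-⊙ X (Q m) ⟨
    ψ (X ⊙ Q m)                  H.≈⟨ ψ-cong (X-Q m) ⟩
    ψ (dilate m β ⊕ ⊝ β)         H.≈⟨ ψ-⊕ (dilate m β) (⊝ β) ⟩
    Bₘ ⊕ ψ (⊝ β)                 H.≈⟨ H.+-congˡ {Bₘ} (ψ-⊝ β) ⟩
    Bₘ ⊕ ⊝ B                     H.∎

  W-L-Z-P : W ⊙ (L ⊙ Z ⊙ P) ≗ M ⊙ L ⊙ W
  W-L-Z-P = H.begin
    W ⊙ (L ⊙ Z ⊙ P)
      -- Distributing L over Z pays off because L = y B: the sum y B + y (Bₘ - B) collapses to y Bₘ.
      H.≈⟨ solve 5 (λ w l x q p → w :* (l :* (con 1ℚ :+ x :* q) :* p) := w :* ((l :+ x :* (l :* q)) :* p)) (λ _ → refl) W L X (ψ (Q m)) P ⟩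
    W ⊙ ((L ⊕ X ⊙ (L ⊙ ψ (Q m))) ⊙ P)
      H.≈⟨ H.*-congˡ {W} (H.*-congʳ {P} (H.+-cong (H.sym B-X) (H.*-congˡ {X} L-ψQ))) ⟩
    W ⊙ ((B ⊙ X ⊕ X ⊙ (Bₘ ⊕ ⊝ B)) ⊙ P)
      H.≈⟨ solve 5 (λ w b x c p → w :* ((b :* x :+ x :* (c :- b)) :* p) := c :* (w :* (x :* p))) (λ _ → refl) W B X Bₘ P ⟩
    Bₘ ⊙ (W ⊙ (X ⊙ P))
      H.≈⟨ H.*-congˡ {Bₘ} (Ψ-geometric m) ⟩
    Bₘ ⊙ (W ⊕ ⊝ const 1ℚ)
      H.≈⟨ Bₘ-W ⟩
    M ⊙ L ⊙ W H.∎

-- Iterating the step leaves a tail divisible by ever higher powers of y, so each coefficient is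
-- settled after finitely many steps; hence induction on the index, with c and F shifted.
ordinary-⊙-unfold : ∀ c (F : ℕ → Series) P → (∀ k → F k ≗ const (c k) ⊙ P ⊕ up (F (suc k))) → ordinary c ⊙ P ≗ F 0
ordinary-⊙-unfold c F P step zero    = trans (ordinary-⊙ c P 0) (sym (step 0 0))
ordinary-⊙-unfold c F P step (suc n) = begin
  (ordinary c ⊙ P) (suc n)
    ≡⟨ ordinary-⊙ c P (suc n) ⟩
  (const (c 0) ⊙ P) (suc n) + fromℕ (suc n) * (ordinary (c ∘ suc) ⊙ P) n
    ≡⟨ cong (λ x → (const (c 0) ⊙ P) (suc n) + fromℕ (suc n) * x) (ordinary-⊙-unfold (c ∘ suc) (F ∘ suc) P (step ∘ suc) n) ⟩
  (const (c 0) ⊙ P) (suc n) + fromℕ (suc n) * F 1 n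
    ≡⟨ step 0 (suc n) ⟨
  F 0 (suc n) ∎
  where open ≡-Reasoning

eval-Ψ : ∀ m → eval (Ψ m) 1ℚ ≡ fromℕ m
eval-Ψ zero    = refl
eval-Ψ (suc m) = trans (cong (_+_ 1ℚ) (trans (*-identityˡ _) (eval-Ψ m))) (sym (fromℕ-suc m))

-- Compares coefficients of yⁿ⁺¹ in ∑ fₖ(1) yᵏ = 1 + y `ψ (Q m)`. The factor y is the reason for k -
-- 1 in the factorial and in the Stirling numbers.
f-value : ∀ m-2 n → let m = suc (suc m-2) in eval (fₚ m (suc n)) 1ℚ ≡ 1/[ n !] * ψ (Q m) n
f-value m-2 n = begin
  v                                     ≡⟨ *-identityˡ v ⟨
  1ℚ * v                                ≡⟨ cong (_* v) (trans (sym (fromℕ-!-inverse n)) (*-comm (fromℕ (n !)) 1/[ n !])) ⟩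
  1/[ n !] * fromℕ (n !) * v            ≡⟨ *-assoc 1/[ n !] _ _ ⟩
  1/[ n !] * (fromℕ (n !) * v)          ≡⟨ cong (1/[ n !] *_) (fromℕ-cancelˡ (suc n) scaled) ⟩
  1/[ n !] * ψ (Q m) n                  ∎
  where
  open ≡-Reasoning
  m = suc (suc m-2)
  v = eval (fₚ m (suc n)) 1ℚ
  P = ev 1-X (Ψ m)
  Z = const 1ℚ ⊕ X ⊙ ψ (Q m)
  F : ℕ → Series
  F k = ev 1-X (fₚ m k)
  c : ℕ → ℚ
  c k = - proj₁ (f-suc m-2 k)

  F-step : ∀ k → F k ≗ const (c k) ⊙ P ⊕ up (F (suc k))
  F-step k = H.begin
    F k
      H.≈⟨ solve 3 (λ a b x → a := (:- ((con 1ℚ :- (con 1ℚ :- x)) :* b :- a)) :+ x :* b) (λ _ → refl) (F k) (F (suc k)) X ⟩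
    ⊝ ((const 1ℚ ⊕ ⊝ 1-X) ⊙ F (suc k) ⊕ ⊝ F k) ⊕ X ⊙ F (suc k)
      H.≈⟨ H.+-cong (H.-‿cong (proj₂ (f-suc m-2 k) 1-X)) (X-⊙ (F (suc k))) ⟩
    ⊝ (const (proj₁ (f-suc m-2 k)) ⊙ P) ⊕ up (F (suc k))
      H.≈⟨ H.+-congʳ (H.trans (solve 2 (λ c p → :- (c :* p) := (:- c) :* p) (λ _ → refl) (const (proj₁ (f-suc m-2 k))) P)
             (H.*-congʳ {P} (H.sym (const-neg (proj₁ (f-suc m-2 k)))))) ⟩
    const (c k) ⊙ P ⊕ up (F (suc k)) H.∎
    where open H-Solver

  c-value : ∀ k → eval (fₚ m k) 1ℚ ≡ fromℕ m * c k
  c-value k = begin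
    eval (fₚ m k) 1ℚ      ≡⟨ ev-0 1-X (fₚ m k) ⟨
    F k 0                 ≡⟨ F-step k 0 ⟩
    c k * P 0 + 0ℚ        ≡⟨ +-identityʳ _ ⟩
    c k * P 0             ≡⟨ cong (c k *_) (trans (ev-0 1-X (Ψ m)) (eval-Ψ m)) ⟩
    c k * fromℕ m         ≡⟨ *-comm (c k) (fromℕ m) ⟩
    fromℕ m * c k         ∎

  Z≗ : Z ≗ const (fromℕ m) ⊙ ordinary c
  Z≗ = H.begin
    Z                                H.≈⟨ H.*-identityʳ Z ⟨
    -- The unit is f₀, that is `ordinary c ⊙ P`. So `ordinary c` inverts P, and `Z ⊙ P` can be
    -- replaced by m.
    Z ⊙ const 1ℚ                     H.≈⟨ H.*-congˡ {Z} (H.trans (ordinary-⊙-unfold c F P F-step) (f-zero m-2 1-X)) ⟨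
    Z ⊙ (ordinary c ⊙ P)             H.≈⟨ solve 3 (λ z c p → z :* (c :* p) := (z :* p) :* c) (λ _ → refl) Z (ordinary c) P ⟩
    (Z ⊙ P) ⊙ ordinary c             H.≈⟨ H.*-congʳ {ordinary c} (generating-function m) ⟩
    const (fromℕ m) ⊙ ordinary c     H.∎
    where open H-Solver

  scaled : fromℕ (suc n) * (fromℕ (n !) * v) ≡ fromℕ (suc n) * ψ (Q m) n
  scaled = begin
    fromℕ (suc n) * (fromℕ (n !) * v)            ≡⟨ *-assoc (fromℕ (suc n)) _ _ ⟨
    fromℕ (suc n) * fromℕ (n !) * v              ≡⟨ cong₂ _*_ (fromℕ-* (suc n) (n !)) (sym (c-value (suc n))) ⟨
    fromℕ (suc n !) * (fromℕ m * c (suc n))      ≡⟨ solve 3 (λ a b c → a :* (b :* c) := b :* (a :* c)) refl (fromℕ (suc n !)) (fromℕ m) (c (suc n)) ⟩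
    fromℕ m * ordinary c (suc n)                 ≡⟨ const-⊙ (fromℕ m) (ordinary c) (suc n) ⟨
    (const (fromℕ m) ⊙ ordinary c) (suc n)       ≡⟨ Z≗ (suc n) ⟨
    0ℚ + (X ⊙ ψ (Q m)) (suc n)                   ≡⟨ +-identityˡ _ ⟩
    (X ⊙ ψ (Q m)) (suc n)                        ≡⟨ X-⊙ (ψ (Q m)) (suc n) ⟩
    fromℕ (suc n) * ψ (Q m) n                    ∎
    where open ℚ-Solver

-- Kills the term with `Q m 0`, the only one containing B₁, so for k ≥ 2 the sum starts at j = 2.
stirl-suc-0 : ∀ n → stirl (suc n) 0 ≡ 0
stirl-suc-0 zero    = refl
stirl-suc-0 (suc n) = trans (cong (suc n ℕ.*_) (stirl-suc-0 n)) (ℕ.*-zeroʳ (suc n))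

theorem6p9 : (m : ℕ) .{{_ : NonTrivial m}} →
    (eval (fₚ m 1) 1ℚ ≡ (fromℕ m - 1ℚ) * ½)
    × ((k : ℕ) → 2 ℕ.≤ k →
    eval (fₚ m k) 1ℚ ≡
    1/[ k ∸ 1 !] * ∑[ i < k ∸ 1 ]
    (let j = 2 ℕ.+ toℕ i in
    bernoulli j * (+ 1 / j) * fromℕ (stirl (k ∸ 1) (j ∸ 1)) * (fromℕ (m ℕ.^ j) - 1ℚ)))
theorem6p9 m@(suc (suc m-2)) = first , later
  where
  open ≡-Reasoning
  open ℚ-Solver
  first : eval (fₚ m 1) 1ℚ ≡ (fromℕ m - 1ℚ) * ½
  first = begin
    eval (fₚ m 1) 1ℚ                      ≡⟨ f-value m-2 0 ⟩
    -- The value is `Q m 0`, and β₁ = B₁ + 1 evaluates to ½.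
    1ℚ * (½ * (fromℕ (m ℕ.* 1) - 1ℚ))     ≡⟨ cong (λ x → 1ℚ * (½ * (fromℕ x - 1ℚ))) (ℕ.*-identityʳ m) ⟩
    1ℚ * (½ * (fromℕ m - 1ℚ))             ≡⟨ solve 1 (λ x → con 1ℚ :* (con ½ :* (x :- con 1ℚ)) := (x :- con 1ℚ) :* con ½) refl (fromℕ m) ⟩
    (fromℕ m - 1ℚ) * ½                    ∎

  later : (k : ℕ) → 2 ℕ.≤ k →
    eval (fₚ m k) 1ℚ ≡
    1/[ k ∸ 1 !] * ∑[ i < k ∸ 1 ]
    (let j = 2 ℕ.+ toℕ i in
    bernoulli j * (+ 1 / j) * fromℕ (stirl (k ∸ 1) (j ∸ 1)) * (fromℕ (m ℕ.^ j) - 1ℚ))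
  later (suc (suc k)) (s≤s (s≤s z≤n)) = trans (f-value m-2 (suc k)) (cong (1/[ suc k !] *_) (begin
    ψ (Q m) (suc k)
      ≡⟨ ψ-sum (Q m) (suc k) (suc k) ℕ.≤-refl ⟩
    fromℕ (stirl (suc k) 0) * Q m 0 + ∑[ i ≤ k ] (s i * Q m (suc (toℕ i)))
      ≡⟨ cong (_+ ∑[ i ≤ k ] (s i * Q m (suc (toℕ i)))) (trans (cong (λ x → fromℕ x * Q m 0) (stirl-suc-0 k)) (*-zeroˡ (Q m 0))) ⟩
    0ℚ + ∑[ i ≤ k ] (s i * Q m (suc (toℕ i)))
      ≡⟨ +-identityˡ _ ⟩
    ∑[ i ≤ k ] (s i * Q m (suc (toℕ i)))
      ≡⟨ sum-cong-≗ {suc k} term ⟩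
    ∑[ i ≤ k ] (t i) ∎))
    where
    s t : Fin.Fin (suc k) → ℚ
    s i = fromℕ (stirl (suc k) (suc (toℕ i)))
    t i = let j = 2 ℕ.+ toℕ i in bernoulli j * (+ 1 / j) * s i * (fromℕ (m ℕ.^ j) - 1ℚ)
    term : (i : Fin.Fin (suc k)) → s i * Q m (suc (toℕ i)) ≡ t i
    term i = begin
      -- From index 2 on `X` vanishes, so `β` and `bernoulli` agree.
      s i * ((b + X j) * r * p)   ≡⟨ cong (λ x → s i * ((b + x) * r * p)) (*-zeroʳ (fromℕ j)) ⟩
      s i * ((b + 0ℚ) * r * p)    ≡⟨ solve 4 (λ s b r p → s :* ((b :+ con 0ℚ) :* r :* p) := b :* r :* s :* p) refl (s i) b r p ⟩
      b * r * s i * p             ∎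
      where
      j = 2 ℕ.+ toℕ i
      b = bernoulli j
      r = + 1 / j
      p = fromℕ (m ℕ.^ j) - 1ℚ
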